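{- Let $q$ be an odd prime power, $d\ge 3$, $E\subset \mathbb F_q^d$ nonempty, $\lambda=0$, and $0<N<q$ a real number. For $\mathbf{x}\in \mathbb{F}_q^{d-1}$, define $f(\mathbf{x}) := \#\{t \in \mathbb{F}_q : (\mathbf{x},t) \in E\}$. Then $$|\mathcal{T}_1(X_\pi, E, N)| \le \frac{2q^{d-1}N}{(q-N)|E|} \cdot \max_{\mathbf x\in \mathbb{F}_q^{d-1}}f(\mathbf x).$$
   Context: $\mathbb F_q$ is the finite field with $q$ elements. For $\mathbf x\in\mathbb F_q^d$, $\|\mathbf x\|=x_1^2+\cdots+x_d^2$, and $\mathbf x\cdot\mathbf y=\sum_i x_iy_i$. $S^{d-1}=\{\mathbf x\in\mathbb F_q^d:\|\mathbf x\|=1\}$, $\pi=\{\mathbf x\in\mathbb F_q^d: x_d=\lambda\}$ (here $\lambda=0$). $X_\pi$ is the set of lines through the origin (one-dimensional linear subspaces of $\mathbb F_q^d$) that contain a nonzero element of $\pi\cap S^{d-1}$. For a linear subspace $V$, $V^\perp=\{\mathbf x\in\mathbb F_q^d:\mathbf x\cdot\mathbf y=0\ \forall \mathbf y\in V\}$, and $\pi_V(E)=\{\mathbf x+V^\perp:\mathbf x\in\mathbb F_q^d,\ (\mathbf x+V^\perp)\cap E\neq\emptyset\}$, a set of cosets. $\mathcal T_1(X_\pi,E,N)=\{V\in X_\pi: |\pi_V(E)|\le N\}$. -}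

module Defs where

open import Algebra.Apartness.Structures using (IsHeytingField)
open import Data.Fin.Base using (Fin)
open import Data.Integer.Base using (+_)
open import Data.List.Base using (List; []; _∷_; length; filter; map; allFin; cartesianProductWith)
open import Data.List.Extrema.Nat using (max)
open import Data.List.Membership.Propositional using (_∈_)
open import Data.List.Membership.Propositional.Properties using (∈-map⁺; ∈-allFin; ∈-cartesianProductWith⁺; ∈-filter⁺)
open import Data.List.Relation.Unary.All using (All)
open import Data.List.Relation.Unary.Any using (here; there)
open import Data.Nat.Base as ℕ using (ℕ; zero; suc)
import Data.Nat.Properties as ℕ
open import Data.Nat.Divisibility using (_∣_)
open import Data.Nat.Primality using (Prime)
open import Data.Product.Base using (∃; ∃₂; _×_; _,_; proj₁; proj₂)
open import Data.Rational.Base using (ℚ; 0ℚ; 1ℚ; ½; _/_; 1/_; ∣_∣; _+_; _-_; _*_; -_; _≤_; _<_; positive; nonNegative; ≢-nonZero; >-nonZero)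
import Data.Rational.Properties as ℚ
open import Data.Rational.Solver using (module +-*-Solver)
open import Data.Vec.Base as Vec using (Vec; []; _∷_; _∷ʳ_; last; zipWith; replicate; foldr′)
open import Function.Bundles using (_↔_; module Inverse)
open import Level using (0ℓ)
open import Relation.Binary.PropositionalEquality using (_≡_; _≢_; refl; sym; trans; cong; cong₂; subst; subst₂)
open import Relation.Nullary using (¬_; yes; no; contradiction)
open import Relation.Unary using (Pred; Decidable; Satisfiable; _≐_)
open import Relation.Unary.Relation.Binary.Equality using (≐-setoid)
import Data.List.Relation.Unary.Unique.Setoid as UniqueSetoid

------------------------------------------------------------------------
-- The real numbers, as Cauchy sequences of rationals.  No equality of
-- reals is needed; the intended one is x ≤ᵣ y and y ≤ᵣ x.

Cauchy : (ℕ → ℚ) → Set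
Cauchy x = ∀ ε → 0ℚ < ε → ∃ λ M → ∀ m n → M ℕ.≤ m → M ℕ.≤ n → ∣ x m - x n ∣ < ε

record ℝ : Set where
  constructor mkℝ
  field
    seq    : ℕ → ℚ
    cauchy : Cauchy seq

open ℝ public

infix 4 _≤ᵣ_ _<ᵣ_

_≤ᵣ_ : ℝ → ℝ → Set
x ≤ᵣ y = ∀ ε → 0ℚ < ε → ∃ λ M → ∀ n → M ℕ.≤ n → seq x n ≤ seq y n + ε

_<ᵣ_ : ℝ → ℝ → Set
x <ᵣ y = ∃ λ ε → 0ℚ < ε × ∃ λ M → ∀ n → M ℕ.≤ n → seq x n + ε ≤ seq y n

private
  module Identities where
    open +-*-Solver

    restore : ∀ a b → (a - b) + b ≡ a
    restore = solve 2 (λ a b → (a :- b) :+ b := a) refl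

    cancel : ∀ a e → (a + e) - a ≡ e
    cancel = solve 2 (λ a e → (a :+ e) :- a := e) refl

    product-difference : ∀ a b c d → a * (b - d) + d * (a - c) ≡ a * b - c * d
    product-difference = solve 4 (λ a b c d → a :* (b :- d) :+ d :* (a :- c) := a :* b :- c :* d) refl

    factor : ∀ b c e k → b * (e * k) + c * (e * k) ≡ e * ((b + c) * k)
    factor = solve 4 (λ b c e k → b :* (e :* k) :+ c :* (e :* k) := e :* ((b :+ c) :* k)) refl

    difference-difference : ∀ a b c d → (a - c) - (b - d) ≡ (a - b) - (c - d)
    difference-difference = solve 4 (λ a b c d → (a :- c) :- (b :- d) := (a :- b) :- (c :- d)) refl

    expand : ∀ a b u v → u * v * (b - a) ≡ u * (b * v) - v * (a * u)
    expand = solve 4 (λ a b u v → u :* v :* (b :- a) := u :* (b :* v) :- v :* (a :* u)) refl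

    regroup : ∀ c e f → c * c * (e * e * f) ≡ (e * c) * (e * c) * f
    regroup = solve 3 (λ c e f → c :* c :* (e :* e :* f) := (e :* c) :* (e :* c) :* f) refl

    rotate : ∀ u a c → u * (a * c) ≡ (a * u) * c
    rotate = solve 3 (λ u a c → u :* (a :* c) := (a :* u) :* c) refl

  open Identities

  *-pos : ∀ {p q} → 0ℚ < p → 0ℚ < q → 0ℚ < p * q
  *-pos {p} {q} 0<p 0<q = ℚ.positive⁻¹ (p * q) {{ℚ.pos*pos⇒pos p {{positive 0<p}} q {{positive 0<q}}}}

  *-mono : ∀ {a b c d} → 0ℚ ≤ a → 0ℚ ≤ d → a ≤ b → c ≤ d → a * c ≤ b * d
  *-mono {a} {b} {c} {d} 0≤a 0≤d a≤b c≤d = ℚ.≤-trans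
    (ℚ.*-monoˡ-≤-nonNeg a {{nonNegative 0≤a}} c≤d)
    (ℚ.*-monoʳ-≤-nonNeg d {{nonNegative 0≤d}} a≤b)

  *-mono-< : ∀ {a b c d} → 0ℚ ≤ a → 0ℚ < d → a < b → c < d → a * c < b * d
  *-mono-< {a} {b} {c} {d} 0≤a 0<d a<b c<d = ℚ.≤-<-trans
    (ℚ.*-monoˡ-≤-nonNeg a {{nonNegative 0≤a}} (ℚ.<⇒≤ c<d))
    (ℚ.*-monoˡ-<-pos d {{positive 0<d}} a<b)

  pos⁻¹ : ∀ {p} → 0ℚ < p → ∃ λ c → 0ℚ < c × p * c ≡ 1ℚ
  pos⁻¹ {p} 0<p =
      (1/ p) {{>-nonZero 0<p}}
    , ℚ.positive⁻¹ _ {{ℚ.1/pos⇒pos p {{positive 0<p}}}}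
    , ℚ.*-inverseʳ p {{>-nonZero 0<p}}

  m≤⊔ : ∀ a b {n} → a ℕ.⊔ b ℕ.≤ n → a ℕ.≤ n × b ℕ.≤ n
  m≤⊔ a b h = ℕ.≤-trans (ℕ.m≤m⊔n a b) h , ℕ.≤-trans (ℕ.m≤n⊔m a b) h

  bounded : ∀ {x} → Cauchy x → ∃ λ B → 0ℚ < B × ∃ λ M → ∀ n → M ℕ.≤ n → ∣ x n ∣ < B
  bounded {x} cx with cx 1ℚ (ℚ.positive⁻¹ 1ℚ)
  ... | M , close = B , ℚ.≤-<-trans (ℚ.0≤∣p∣ (x M)) (bound M ℕ.≤-refl) , M , bound
    where
    B = 1ℚ + ∣ x M ∣
    bound : ∀ n → M ℕ.≤ n → ∣ x n ∣ < B
    bound n M≤n = ℚ.≤-<-trans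
      (subst (λ z → ∣ z ∣ ≤ ∣ x n - x M ∣ + ∣ x M ∣)
             (restore (x n) (x M))
             (ℚ.∣p+q∣≤∣p∣+∣q∣ (x n - x M) (x M)))
      (ℚ.+-monoˡ-< ∣ x M ∣ (close n M M≤n ℕ.≤-refl))

  product-close : ∀ {a b c d B C k ε} → 0ℚ < ε * k → (B + C) * k ≡ 1ℚ →
    ∣ a ∣ < B → ∣ d ∣ < C → ∣ b - d ∣ < ε * k → ∣ a - c ∣ < ε * k →
    ∣ a * b - c * d ∣ < ε
  product-close {a} {b} {c} {d} {B} {C} {k} {ε} 0<δ inv a<B d<C b~d a~c =
    subst₂ (λ u v → ∣ u ∣ < v) (product-difference a b c d) total
      (ℚ.≤-<-trans (ℚ.∣p+q∣≤∣p∣+∣q∣ (a * (b - d)) (d * (a - c))) (ℚ.+-mono-< p< r<))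
    where
    p< : ∣ a * (b - d) ∣ < B * (ε * k)
    p< = subst (_< B * (ε * k)) (sym (ℚ.∣p*q∣≡∣p∣*∣q∣ a (b - d)))
           (*-mono-< (ℚ.0≤∣p∣ a) 0<δ a<B b~d)
    r< : ∣ d * (a - c) ∣ < C * (ε * k)
    r< = subst (_< C * (ε * k)) (sym (ℚ.∣p*q∣≡∣p∣*∣q∣ d (a - c)))
           (*-mono-< (ℚ.0≤∣p∣ d) 0<δ d<C a~c)
    total : B * (ε * k) + C * (ε * k) ≡ ε
    total = trans (factor B C ε k) (trans (cong (ε *_) inv) (ℚ.*-identityʳ ε))

  difference-close : ∀ {a b c d ε} → ∣ a - c ∣ < ½ * ε → ∣ b - d ∣ < ½ * ε →
    ∣ (a - b) - (c - d) ∣ < ε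
  difference-close {a} {b} {c} {d} {ε} a~c b~d =
    subst₂ (λ u v → ∣ u ∣ < v) (difference-difference a b c d)
      (trans (sym (ℚ.*-distribʳ-+ ε ½ ½)) (ℚ.*-identityˡ ε))
      (ℚ.≤-<-trans (ℚ.∣p-q∣≤∣p∣+∣q∣ (a - c) (b - d)) (ℚ.+-mono-< a~c b~d))

  Bounded : (ℕ → ℚ) → ℚ → ℕ → Set
  Bounded x B M = ∀ n → M ℕ.≤ n → ∣ x n ∣ < B

  Close : (ℕ → ℚ) → ℚ → ℕ → Set
  Close x ε M = ∀ m n → M ℕ.≤ m → M ℕ.≤ n → ∣ x m - x n ∣ < ε

  *-close : ∀ {x y B C k ε M₁ M₂ M₃ M₄} → 0ℚ < ε * k → (B + C) * k ≡ 1ℚ →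
    Bounded x B M₁ → Bounded y C M₂ → Close x (ε * k) M₃ → Close y (ε * k) M₄ →
    Close (λ n → x n * y n) ε ((M₁ ℕ.⊔ M₂) ℕ.⊔ (M₃ ℕ.⊔ M₄))
  *-close {x} {y} {B} {C} {k} {ε} {M₁} {M₂} {M₃} {M₄} 0<δ inv bx by Δx Δy m n hm hn =
    product-close {x m} {y m} {x n} {y n} {B} {C} {k} {ε} 0<δ inv
      (bx m (proj₁ (m≤⊔ M₁ M₂ (proj₁ m≤)))) (by n (proj₂ (m≤⊔ M₁ M₂ (proj₁ n≤))))
      (Δy m n (proj₂ (m≤⊔ M₃ M₄ (proj₂ m≤))) (proj₂ (m≤⊔ M₃ M₄ (proj₂ n≤))))
      (Δx m n (proj₁ (m≤⊔ M₃ M₄ (proj₂ m≤))) (proj₁ (m≤⊔ M₃ M₄ (proj₂ n≤))))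
    where
    m≤ = m≤⊔ (M₁ ℕ.⊔ M₂) (M₃ ℕ.⊔ M₄) hm
    n≤ = m≤⊔ (M₁ ℕ.⊔ M₂) (M₃ ℕ.⊔ M₄) hn

  *-cauchy : ∀ {x y} → Cauchy x → Cauchy y → Cauchy (λ n → x n * y n)
  *-cauchy {x} {y} cx cy ε 0<ε = bounds (bounded {x} cx) (bounded {y} cy)
    where
    Goal = ∃ (Close (λ n → x n * y n) ε)
    moduli : ∀ {B C k M₁ M₂} → 0ℚ < ε * k → (B + C) * k ≡ 1ℚ → Bounded x B M₁ → Bounded y C M₂ →
             ∃ (Close x (ε * k)) → ∃ (Close y (ε * k)) → Goal
    moduli {B} {C} {k} 0<δ inv bx by (M₃ , Δx) (M₄ , Δy) =
      _ , *-close {x} {y} {B} {C} {k} {ε} 0<δ inv bx by Δx Δy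
    inverse : ∀ {B C M₁ M₂} → Bounded x B M₁ → Bounded y C M₂ →
              (∃ λ k → 0ℚ < k × (B + C) * k ≡ 1ℚ) → Goal
    inverse {B} {C} bx by (k , 0<k , inv) =
      moduli {B} {C} {k} (*-pos 0<ε 0<k) inv bx by
        (cx (ε * k) (*-pos 0<ε 0<k)) (cy (ε * k) (*-pos 0<ε 0<k))
    bounds : (∃ λ B → 0ℚ < B × ∃ (Bounded x B)) → (∃ λ C → 0ℚ < C × ∃ (Bounded y C)) → Goal
    bounds (B , 0<B , _ , bx) (C , 0<C , _ , by) =
      inverse {B} {C} bx by (pos⁻¹ {B + C} (ℚ.+-mono-< 0<B 0<C))

  minus-cauchy : ∀ {x y} → Cauchy x → Cauchy y → Cauchy (λ n → x n - y n)
  minus-cauchy {x} {y} cx cy ε 0<ε = moduli (cx (½ * ε) 0<½ε) (cy (½ * ε) 0<½ε)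
    where
    0<½ε : 0ℚ < ½ * ε
    0<½ε = *-pos (ℚ.positive⁻¹ ½) 0<ε
    moduli : ∃ (Close x (½ * ε)) → ∃ (Close y (½ * ε)) → ∃ (Close (λ n → x n - y n) ε)
    moduli (M₁ , Δx) (M₂ , Δy) = M₁ ℕ.⊔ M₂ , λ m n hm hn →
      difference-close {x m} {y m} {x n} {y n} {ε}
        (Δx m n (proj₁ (m≤⊔ M₁ M₂ hm)) (proj₁ (m≤⊔ M₁ M₂ hn)))
        (Δy m n (proj₂ (m≤⊔ M₁ M₂ hm)) (proj₂ (m≤⊔ M₁ M₂ hn)))

-- Total on ℚ, so that reciprocals of sequences can be taken termwise: a
-- sequence with positive limit may have finitely many zero terms.
recipℚ : ℚ → ℚ
recipℚ p with p ℚ.≟ 0ℚ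
... | yes _  = 0ℚ
... | no p≢0 = (1/ p) {{≢-nonZero p≢0}}

recipℚ-inverse : ∀ p → p ≢ 0ℚ → p * recipℚ p ≡ 1ℚ
recipℚ-inverse p p≢0 with p ℚ.≟ 0ℚ
... | yes p≡0 = contradiction p≡0 p≢0
... | no p≢0′ = ℚ.*-inverseʳ p {{≢-nonZero p≢0′}}

recipℚ-nonNeg : ∀ p → 0ℚ ≤ p → 0ℚ ≤ recipℚ p
recipℚ-nonNeg p 0≤p with p ℚ.≟ 0ℚ
... | yes _  = ℚ.≤-refl
... | no p≢0 = ℚ.<⇒≤ (ℚ.positive⁻¹ _ {{ℚ.1/pos⇒pos p
                 {{ℚ.nonNeg∧nonZero⇒pos p {{nonNegative 0≤p}} {{≢-nonZero p≢0}}}}}})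

private
  module ReciprocalClose {ε₀ c ε : ℚ} (0<ε₀ : 0ℚ < ε₀) (0<c : 0ℚ < c) (inv : ε₀ * c ≡ 1ℚ) where

    recip≤ : ∀ {a} u → ε₀ ≤ a → 0ℚ ≤ u → a * u ≡ 1ℚ → u ≤ c
    recip≤ {a} u ε₀≤a 0≤u au = subst₂ _≤_
      (trans (cong (u *_) inv) (ℚ.*-identityʳ u))
      (trans (rotate u a c) (trans (cong (_* c) au) (ℚ.*-identityˡ c)))
      (ℚ.*-monoˡ-≤-nonNeg u {{nonNegative 0≤u}}
        (ℚ.*-monoʳ-≤-nonNeg c {{nonNegative (ℚ.<⇒≤ 0<c)}} ε₀≤a))

    recip-close : ∀ {a b} u v → ε₀ ≤ a → ε₀ ≤ b → 0ℚ ≤ u → 0ℚ ≤ v → a * u ≡ 1ℚ → b * v ≡ 1ℚ →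
                  ∣ b - a ∣ < ε₀ * ε₀ * ε → ∣ u - v ∣ < ε
    recip-close {a} {b} u v ε₀≤a ε₀≤b 0≤u 0≤v au bv near = subst₂ _<_ (sym abs) total
      (ℚ.≤-<-trans (ℚ.*-monoʳ-≤-nonNeg ∣ b - a ∣ {{nonNegative (ℚ.0≤∣p∣ (b - a))}} uv≤)
                   (ℚ.*-monoʳ-<-pos (c * c) {{positive (*-pos 0<c 0<c)}} near))
      where
      eq : u * v * (b - a) ≡ u - v
      eq = trans (expand a b u v)
             (trans (cong₂ (λ s t → u * s - v * t) bv au)
                    (cong₂ _-_ (ℚ.*-identityʳ u) (ℚ.*-identityʳ v)))
      0≤uv : 0ℚ ≤ u * v
      0≤uv = subst (_≤ u * v) (ℚ.*-zeroˡ v) (*-mono ℚ.≤-refl 0≤v 0≤u ℚ.≤-refl)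
      abs : ∣ u - v ∣ ≡ u * v * ∣ b - a ∣
      abs = trans (cong ∣_∣ (sym eq))
              (trans (ℚ.∣p*q∣≡∣p∣*∣q∣ (u * v) (b - a))
                     (cong (_* ∣ b - a ∣) (ℚ.0≤p⇒∣p∣≡p 0≤uv)))
      uv≤ : u * v ≤ c * c
      uv≤ = *-mono 0≤u (ℚ.<⇒≤ 0<c) (recip≤ u ε₀≤a 0≤u au) (recip≤ v ε₀≤b 0≤v bv)
      total : c * c * (ε₀ * ε₀ * ε) ≡ ε
      total = trans (regroup c ε₀ ε) (trans (cong (λ t → t * t * ε) inv) (ℚ.*-identityˡ ε))

  recip-cauchy : ∀ {x ε₀ M₀} → 0ℚ < ε₀ → (∀ n → M₀ ℕ.≤ n → ε₀ ≤ x n) →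
                 Cauchy x → Cauchy (λ n → recipℚ (x n))
  recip-cauchy {x} {ε₀} {M₀} 0<ε₀ low cx ε 0<ε = inverse (pos⁻¹ 0<ε₀)
    where
    0<x : ∀ n → M₀ ℕ.≤ n → 0ℚ < x n
    0<x n h = ℚ.<-≤-trans 0<ε₀ (low n h)
    0≤u : ∀ n → M₀ ℕ.≤ n → 0ℚ ≤ recipℚ (x n)
    0≤u n h = recipℚ-nonNeg (x n) (ℚ.<⇒≤ (0<x n h))
    xu : ∀ n → M₀ ℕ.≤ n → x n * recipℚ (x n) ≡ 1ℚ
    xu n h = recipℚ-inverse (x n) (λ e → ℚ.<⇒≢ (0<x n h) (sym e))
    Goal = ∃ (Close (λ n → recipℚ (x n)) ε)
    modulus : ∀ {c} → 0ℚ < c → ε₀ * c ≡ 1ℚ → ∃ (Close x (ε₀ * ε₀ * ε)) → Goal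
    modulus {c} 0<c inv (M₁ , Δx) = M₀ ℕ.⊔ M₁ , λ m n hm hn →
      ReciprocalClose.recip-close {ε₀} {c} {ε} 0<ε₀ 0<c inv {x m} {x n}
        (recipℚ (x m)) (recipℚ (x n))
        (low m (proj₁ (m≤⊔ M₀ M₁ hm))) (low n (proj₁ (m≤⊔ M₀ M₁ hn)))
        (0≤u m (proj₁ (m≤⊔ M₀ M₁ hm))) (0≤u n (proj₁ (m≤⊔ M₀ M₁ hn)))
        (xu m (proj₁ (m≤⊔ M₀ M₁ hm))) (xu n (proj₁ (m≤⊔ M₀ M₁ hn)))
        (Δx n m (proj₂ (m≤⊔ M₀ M₁ hn)) (proj₂ (m≤⊔ M₀ M₁ hm)))
    inverse : (∃ λ c → 0ℚ < c × ε₀ * c ≡ 1ℚ) → Goal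
    inverse (c , 0<c , inv) =
      modulus 0<c inv (cx (ε₀ * ε₀ * ε) (*-pos {ε₀ * ε₀} {ε} (*-pos 0<ε₀ 0<ε₀) 0<ε))

fromℚ : ℚ → ℝ
fromℚ p = mkℝ (λ _ → p) λ ε 0<ε → 0 , λ _ _ _ _ →
  subst (λ z → ∣ z ∣ < ε) (sym (ℚ.+-inverseʳ p)) 0<ε

fromℕ : ℕ → ℝ
fromℕ n = fromℚ (+ n / 1)

infixl 6 _-ᵣ_
infixl 7 _*ᵣ_ _/ᵣ_[_]

_-ᵣ_ : ℝ → ℝ → ℝ
mkℝ x cx -ᵣ mkℝ y cy = mkℝ (λ n → x n - y n) (minus-cauchy {x} {y} cx cy)

_*ᵣ_ : ℝ → ℝ → ℝ
mkℝ x cx *ᵣ mkℝ y cy = mkℝ (λ n → x n * y n) (*-cauchy {x} {y} cx cy)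

recip : (x : ℝ) → fromℕ 0 <ᵣ x → ℝ
recip (mkℝ x cx) (ε₀ , 0<ε₀ , M₀ , low) = mkℝ (λ n → recipℚ (x n))
  (recip-cauchy {x} 0<ε₀ (λ n h → subst (_≤ x n) (ℚ.+-identityˡ ε₀) (low n h)) cx)

-- x /ᵣ y [ 0<y ] is the quotient of x by the positive real y.
_/ᵣ_[_] : (x y : ℝ) → fromℕ 0 <ᵣ y → ℝ
x /ᵣ y [ 0<y ] = x *ᵣ recip y 0<y

x<y⇒0<y-x : ∀ {x y} → x <ᵣ y → fromℕ 0 <ᵣ (y -ᵣ x)
x<y⇒0<y-x {x} {y} (ε , 0<ε , M , h) = ε , 0<ε , M , λ n M≤n →
  let a = seq x n
  in subst (_≤ seq y n - a)
       (trans (cancel a ε) (sym (ℚ.+-identityˡ ε)))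
       (ℚ.+-monoˡ-≤ (- a) (h n M≤n))

0<x*y : ∀ {x y} → fromℕ 0 <ᵣ x → fromℕ 0 <ᵣ y → fromℕ 0 <ᵣ (x *ᵣ y)
0<x*y {x} {y} (ε , 0<ε , M , h) (δ , 0<δ , L , k) =
  ε * δ , *-pos 0<ε 0<δ , M ℕ.⊔ L , λ n le →
  let (l₁ , l₂) = m≤⊔ M L le
      ε≤x = subst (_≤ seq x n) (ℚ.+-identityˡ ε) (h n l₁)
      δ≤y = subst (_≤ seq y n) (ℚ.+-identityˡ δ) (k n l₂)
  in subst (_≤ seq x n * seq y n) (sym (ℚ.+-identityˡ (ε * δ)))
       (*-mono (ℚ.<⇒≤ 0<ε) (ℚ.≤-trans (ℚ.<⇒≤ 0<δ) δ≤y) ε≤x δ≤y)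

0<fromℕ : ∀ {n} → 0 ℕ.< n → fromℕ 0 <ᵣ fromℕ n
0<fromℕ {suc n} _ = + suc n / 1 , ℚ.positive⁻¹ _ {{ℚ.normalize-pos (suc n) 1}} , 0 ,
  λ _ _ → ℚ.≤-reflexive (ℚ.+-identityˡ (+ suc n / 1))

------------------------------------------------------------------------
-- Finite fields

OddPrimePower : ℕ → Set
OddPrimePower q = (∃₂ λ p k → Prime p × 1 ℕ.≤ k × q ≡ p ℕ.^ k) × ¬ (2 ∣ q)

-- With apartness taken to be ≢, a Heyting field is a field in the usual
-- sense: differences are invertible exactly when they are nonzero (so in
-- particular 0# ≢ 1#).
record FiniteField (q : ℕ) : Set₁ where
  infix  8 ⊖_
  infixl 7 _⊗_
  infixl 6 _⊕_
  field
    Carrier        : Set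
    _⊕_ _⊗_        : Carrier → Carrier → Carrier
    ⊖_             : Carrier → Carrier
    0# 1#          : Carrier
    isHeytingField : IsHeytingField _≡_ _≢_ _⊕_ _⊗_ ⊖_ 0# 1#
    finite         : Fin q ↔ Carrier

module Geometry {q : ℕ} (F : FiniteField q) where

  open FiniteField F public

  𝔽^_ : ℕ → Set
  𝔽^ d = Vec Carrier d

  elements : List Carrier
  elements = map (Inverse.to finite) (allFin q)

  vectors : ∀ d → List (𝔽^ d)
  vectors zero    = [] ∷ []
  vectors (suc d) = cartesianProductWith _∷_ elements (vectors d)

  ∈-elements : ∀ t → t ∈ elements
  ∈-elements t = subst (_∈ elements) (Inverse.strictlyInverseˡ finite t)
    (∈-map⁺ (Inverse.to finite) (∈-allFin (Inverse.from finite t)))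

  ∈-vectors : ∀ {d} (x : 𝔽^ d) → x ∈ vectors d
  ∈-vectors []      = here refl
  ∈-vectors (t ∷ x) = ∈-cartesianProductWith⁺ _∷_ (∈-elements t) (∈-vectors x)

  #_ : ∀ {d} {E : Pred (𝔽^ d) 0ℓ} → Decidable E → ℕ
  #_ {d} E? = length (filter E? (vectors d))

  0<# : ∀ {d} {E : Pred (𝔽^ d) 0ℓ} (E? : Decidable E) → Satisfiable E → 0 ℕ.< # E?
  0<# E? (x , x∈E) with filter E? (vectors _) | ∈-filter⁺ E? (∈-vectors x) x∈E
  ... | _ ∷ _ | _ = ℕ.s≤s ℕ.z≤n

  -- Vectors of 𝔽^(d-1) × 𝔽 are identified with vectors of 𝔽^d by x ∷ʳ t,
  -- so the distinguished coordinate is the last one.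
  fibreSize : ∀ {m} {E : Pred (𝔽^ suc m) 0ℓ} → Decidable E → 𝔽^ m → ℕ
  fibreSize E? x = length (filter (λ t → E? (x ∷ʳ t)) elements)

  -- The base value 0 has no effect: the list is nonempty.
  maxFibreSize : ∀ {m} {E : Pred (𝔽^ suc m) 0ℓ} → Decidable E → ℕ
  maxFibreSize {m} E? = max 0 (map (fibreSize E?) (vectors m))

  module _ {d : ℕ} where

    0ᵥ : 𝔽^ d
    0ᵥ = replicate d 0#

    infixl 6 _+ᵥ_
    infixr 7 _·ᵥ_
    infix  7 _∙_

    _+ᵥ_ : 𝔽^ d → 𝔽^ d → 𝔽^ d
    _+ᵥ_ = zipWith _⊕_

    _·ᵥ_ : Carrier → 𝔽^ d → 𝔽^ d
    c ·ᵥ x = Vec.map (c ⊗_) x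

    _∙_ : 𝔽^ d → 𝔽^ d → Carrier
    x ∙ y = foldr′ _⊕_ 0# (zipWith _⊗_ x y)

    ‖_‖ : 𝔽^ d → Carrier
    ‖ x ‖ = x ∙ x

    Sphere : Pred (𝔽^ d) 0ℓ
    Sphere x = ‖ x ‖ ≡ 1#

    record IsSubspace (V : Pred (𝔽^ d) 0ℓ) : Set where
      field
        0∈ : V 0ᵥ
        +∈ : ∀ {x y} → V x → V y → V (x +ᵥ y)
        ·∈ : ∀ c {x} → V x → V (c ·ᵥ x)

    IsLine : Pred (Pred (𝔽^ d) 0ℓ) 0ℓ
    IsLine V = IsSubspace V × ∃ λ v → V v × v ≢ 0ᵥ × (∀ x → V x → ∃ λ c → x ≡ c ·ᵥ v)

    _^⊥ : Pred (𝔽^ d) 0ℓ → Pred (𝔽^ d) 0ℓ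
    (V ^⊥) x = ∀ y → V y → x ∙ y ≡ 0#

    Coset : 𝔽^ d → Pred (𝔽^ d) 0ℓ → Pred (𝔽^ d) 0ℓ
    Coset x W z = ∃ λ w → W w × z ≡ x +ᵥ w

    -- The set of cosets of V^⊥ that meet E.
    Projection : Pred (𝔽^ d) 0ℓ → Pred (𝔽^ d) 0ℓ → Pred (Pred (𝔽^ d) 0ℓ) 0ℓ
    Projection V E C = ∃ λ x → C ≐ Coset x (V ^⊥) × ∃ λ z → Coset x (V ^⊥) z × E z

    -- ∣ 𝒞 ∣≤ r bounds the cardinality of a family of subsets of 𝔽^d, subsets
    -- being compared extensionally: lists of pairwise distinct members of 𝒞
    -- have length at most r.
    ∣_∣≤_ : ∀ {ℓ} → Pred (Pred (𝔽^ d) 0ℓ) ℓ → ℝ → Set _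
    ∣ 𝒞 ∣≤ r = ∀ Vs → Unique Vs → All 𝒞 Vs → fromℕ (length Vs) ≤ᵣ r
      where open UniqueSetoid (≐-setoid (𝔽^ d) 0ℓ) using (Unique)

    𝒯₁ : Pred (Pred (𝔽^ d) 0ℓ) 0ℓ → Pred (𝔽^ d) 0ℓ → ℝ → Pred (Pred (𝔽^ d) 0ℓ) _
    𝒯₁ 𝒳 E N V = 𝒳 V × ∣ Projection V E ∣≤ N

  Hyperplane : ∀ {m} → Carrier → Pred (𝔽^ suc m) 0ℓ
  Hyperplane λ₀ x = last x ≡ λ₀

  LinesMeeting : ∀ {m} → Carrier → Pred (Pred (𝔽^ suc m) 0ℓ) 0ℓ
  LinesMeeting λ₀ V = IsLine V × ∃ λ x → V x × x ≢ 0ᵥ × Hyperplane λ₀ x × Sphere x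

  0<[q-N]#E : ∀ {d} N {E : Pred (𝔽^ d) 0ℓ} (E? : Decidable E) → Satisfiable E →
              N <ᵣ fromℕ q → fromℕ 0 <ᵣ ((fromℕ q -ᵣ N) *ᵣ fromℕ (# E?))
  0<[q-N]#E N E? E≠∅ N<q = 0<x*y {fromℕ q -ᵣ N} {fromℕ (# E?)}
    (x<y⇒0<y-x {N} {fromℕ q} N<q) (0<fromℕ (0<# E? E≠∅))

{-# OPTIONS --safe #-}
-- A line V in the hyperplane x_d = 0 is spanned by some (w , 0), and the number of cosets of V^⊥ that
-- meet E is the number of values of w · x′ for (x′ , t) ∈ E.  Let energy w be the number of pairs of
-- points of E on which w takes the same value.  By Cauchy-Schwarz ∣E∣² ≤ n · energy w as soon as w takes
-- at most n values, and in particular excess w = q · energy w − ∣E∣² is nonnegative for every w.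
-- Counting hyperplanes through differences of points bounds the sum of the excess over all w in 𝔽^(d-1)
-- by (q − 1) q^(d-1) ∣E∣ max f, the pairs with equal x′ being the only ones that contribute.  The excess
-- is constant on the q − 1 nonzero multiples of w, so its sum over one direction per line is at most
-- q^(d-1) ∣E∣ max f, whereas each line of 𝒯₁ contributes at least (q − N) ∣E∣² / N.
-- This elementary form of Plancherel's identity gives the bound even without the factor 2.
module Submission where

import Algebra.Apartness.Structures as Apartness
open import Algebra.Bundles using (CommutativeRing)
import Algebra.Properties.AbelianGroup as AbelianGroupProperties
import Algebra.Properties.Group as GroupProperties
import Algebra.Properties.Ring as RingProperties
import Data.Fin.Properties as Fin
import Data.Integer.Base as ℤ
import Data.Integer.Properties as ℤ
open import Data.List.Base using (List; []; _∷_; _++_; length; map; filter; cartesianProductWith; concat; allFin; deduplicate)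
open import Data.List.Extrema.Nat using (xs≤max)
open import Data.List.Membership.Propositional using (_∈_)
open import Data.List.Membership.Propositional.Properties
  using (∈-map⁺; ∈-map⁻; ∈-filter⁺; ∈-filter⁻; ∈-deduplicate⁻)
open import Data.List.Properties using (length-map; length-tabulate; map-∘; map-++)
open import Data.List.Relation.Binary.Disjoint.Propositional using (Disjoint)
open import Data.List.Relation.Unary.All as All using (All; []; _∷_)
import Data.List.Relation.Unary.All.Properties as All
open import Data.List.Relation.Unary.AllPairs as AllPairs using (AllPairs; []; _∷_)
import Data.List.Relation.Unary.AllPairs.Properties as AllPairs
open import Data.List.Relation.Unary.Any as Any using (here; there)
import Data.List.Relation.Unary.Any.Properties as Any
open import Data.List.Relation.Unary.Unique.Propositional using (Unique)
import Data.List.Relation.Unary.Unique.DecSetoid.Properties as UniqueDecSetoid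
import Data.List.Relation.Unary.Unique.Propositional.Properties as Unique
open import Data.Nat.Base
open import Data.Nat.ListAction using (sum)
open import Data.Nat.ListAction.Properties using (sum-++)
open import Data.Nat.Properties as ℕ
open import Data.Nat.Tactic.RingSolver using (solve-∀)
open import Data.Product.Base using (∃; _×_; _,_; proj₁; proj₂)
open import Data.Rational.Base as ℚ using (ℚ; 0ℚ; 1ℚ; 1/_; toℚᵘ)
import Data.Rational.Properties as ℚ
open import Data.Rational.Solver as ℚ using ()
open import Data.Rational.Unnormalised.Base as ℚᵘ using (mkℚᵘ; *≡*; *≤*)
import Data.Rational.Unnormalised.Properties as ℚᵘ
open import Data.Sum.Base using ([_,_]′)
open import Data.Vec.Base using ([]; _∷_; _∷ʳ_; init; last; initLast)
import Data.Vec.Properties as Vec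
open import Function.Base using (_∘_; id)
open import Function.Bundles using (Inverse)
open import Function.Properties.Inverse using (↔-sym; ↔⇒↣)
open import Level using (Level; 0ℓ)
import Relation.Binary.Construct.On as On
open import Relation.Binary.Definitions using (DecidableEquality)
open import Relation.Binary.PropositionalEquality
open import Relation.Nullary using (Dec; yes; no; ¬_; ¬?; contradiction)
open import Relation.Nullary.Decidable using (via-injection)
open import Relation.Unary using (Pred; Decidable; Satisfiable; _≐_)
open import Defs

private
  variable
    ℓ ℓ₁ ℓ₂ ℓ₃ : Level
    A : Set ℓ₁
    B : Set ℓ₂
    C : Set ℓ₃
    P : Set ℓ₁
    R : Set ℓ₂

-- Finite sums over lists

∑ : List A → (A → ℕ) → ℕ
∑ xs f = sum (map f xs)

infix 5 ∑
syntax ∑ xs (λ x → e) = ∑[ x ← xs ] e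

∑-mono-∈ : ∀ (xs : List A) {f g} → (∀ {x} → x ∈ xs → f x ≤ g x) → ∑ xs f ≤ ∑ xs g
∑-mono-∈ []       f≤g = z≤n
∑-mono-∈ (x ∷ xs) f≤g = +-mono-≤ (f≤g (here refl)) (∑-mono-∈ xs (f≤g ∘ there))

∑-mono : ∀ (xs : List A) {f g} → (∀ x → f x ≤ g x) → ∑ xs f ≤ ∑ xs g
∑-mono xs f≤g = ∑-mono-∈ xs (λ {x} _ → f≤g x)

∑-cong-∈ : ∀ (xs : List A) {f g} → (∀ {x} → x ∈ xs → f x ≡ g x) → ∑ xs f ≡ ∑ xs g
∑-cong-∈ []       f≡g = refl
∑-cong-∈ (x ∷ xs) f≡g = cong₂ _+_ (f≡g (here refl)) (∑-cong-∈ xs (f≡g ∘ there))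

∑-cong : ∀ (xs : List A) {f g} → (∀ x → f x ≡ g x) → ∑ xs f ≡ ∑ xs g
∑-cong xs f≡g = ∑-cong-∈ xs (λ {x} _ → f≡g x)

∑-+ : ∀ (xs : List A) f g → ∑[ x ← xs ] (f x + g x) ≡ ∑ xs f + ∑ xs g
∑-+ []       f g = refl
∑-+ (x ∷ xs) f g = trans (cong (f x + g x +_) (∑-+ xs f g)) (interchange (f x) (g x) _ _)
  where
  interchange : ∀ a b c d → a + b + (c + d) ≡ a + c + (b + d)
  interchange = solve-∀

∑-*ˡ : ∀ k (xs : List A) f → ∑[ x ← xs ] (k * f x) ≡ k * ∑ xs f
∑-*ˡ k []       f = sym (*-zeroʳ k)
∑-*ˡ k (x ∷ xs) f = trans (cong (k * f x +_) (∑-*ˡ k xs f)) (sym (*-distribˡ-+ k (f x) _))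

∑-*ʳ : ∀ k (xs : List A) f → ∑[ x ← xs ] (f x * k) ≡ ∑ xs f * k
∑-*ʳ k xs f = trans (∑-cong xs (λ x → *-comm (f x) k)) (trans (∑-*ˡ k xs f) (*-comm k _))

∑-const : ∀ k (xs : List A) → ∑[ _ ← xs ] k ≡ length xs * k
∑-const k []       = refl
∑-const k (x ∷ xs) = cong (k +_) (∑-const k xs)

∑-swap : ∀ (xs : List A) (ys : List B) (f : A → B → ℕ) →
         ∑[ x ← xs ] ∑[ y ← ys ] f x y ≡ ∑[ y ← ys ] ∑[ x ← xs ] f x y
∑-swap []       ys f = sym (trans (∑-const 0 ys) (*-zeroʳ (length ys)))
∑-swap (x ∷ xs) ys f = trans (cong (∑ ys (f x) +_) (∑-swap xs ys f)) (sym (∑-+ ys (f x) _))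

∑-++ : ∀ (xs ys : List A) f → ∑ (xs ++ ys) f ≡ ∑ xs f + ∑ ys f
∑-++ xs ys f = trans (cong sum (map-++ f xs ys)) (sum-++ (map f xs) (map f ys))

∑-map : ∀ (g : A → B) xs f → ∑ (map g xs) f ≡ ∑ xs (f ∘ g)
∑-map g xs f = cong sum (sym (map-∘ xs))

∑-concat-map : ∀ (g : A → List B) xs f → ∑ (concat (map g xs)) f ≡ ∑[ x ← xs ] ∑ (g x) f
∑-concat-map g []       f = refl
∑-concat-map g (x ∷ xs) f =
  trans (∑-++ (g x) (concat (map g xs)) f) (cong (∑ (g x) f +_) (∑-concat-map g xs f))

∑-cartesianProductWith : ∀ (g : A → B → C) xs ys f →
  ∑ (cartesianProductWith g xs ys) f ≡ ∑[ x ← xs ] ∑[ y ← ys ] f (g x y)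
∑-cartesianProductWith g []       ys f = refl
∑-cartesianProductWith g (x ∷ xs) ys f = trans
  (∑-++ (map (g x) ys) (cartesianProductWith g xs ys) f)
  (cong₂ _+_ (∑-map (g x) ys f) (∑-cartesianProductWith g xs ys f))

∑-*-∑ : ∀ (xs : List A) (ys : List B) f g →
        ∑ xs f * ∑ ys g ≡ ∑[ x ← xs ] ∑[ y ← ys ] (f x * g y)
∑-*-∑ xs ys f g = trans (sym (∑-*ʳ (∑ ys g) xs f)) (∑-cong xs (λ x → sym (∑-*ˡ (f x) ys g)))

-- Indicators of decidable propositions and their sums

𝟙 : Dec P → ℕ
𝟙 (yes _) = 1
𝟙 (no _)  = 0

𝟙-yes : (d : Dec P) → P → 𝟙 d ≡ 1
𝟙-yes (yes _) _ = refl
𝟙-yes (no ¬p) p = contradiction p ¬p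

𝟙-no : (d : Dec P) → ¬ P → 𝟙 d ≡ 0
𝟙-no (yes p) ¬p = contradiction p ¬p
𝟙-no (no _)  _  = refl

𝟙-mono : (d : Dec P) (e : Dec R) → (P → R) → 𝟙 d ≤ 𝟙 e
𝟙-mono (yes p) e f = ≤-reflexive (sym (𝟙-yes e (f p)))
𝟙-mono (no _)  e f = z≤n

module _ {P : Pred A ℓ} (P? : Decidable P) where

  ∑-𝟙-filter : ∀ xs → ∑[ x ← xs ] 𝟙 (P? x) ≡ length (filter P? xs)
  ∑-𝟙-filter [] = refl
  ∑-𝟙-filter (x ∷ xs) with P? x
  ... | yes _ = cong suc (∑-𝟙-filter xs)
  ... | no _  = ∑-𝟙-filter xs

  ∑-𝟙-none : ∀ xs → (∀ {x} → x ∈ xs → ¬ P x) → ∑[ x ← xs ] 𝟙 (P? x) ≡ 0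
  ∑-𝟙-none []       none = refl
  ∑-𝟙-none (x ∷ xs) none =
    cong₂ _+_ (𝟙-no (P? x) (none (here refl))) (∑-𝟙-none xs (none ∘ there))

  ∑-𝟙-unique : ∀ {xs} → Unique xs → (∀ {x y} → P x → P y → x ≡ y) →
               ∑[ x ← xs ] 𝟙 (P? x) ≤ 1
  ∑-𝟙-unique []                    uni = z≤n
  ∑-𝟙-unique (_∷_ {x} {xs} x∉ u) uni with P? x
  ... | yes px = s≤s (≤-reflexive (∑-𝟙-none xs (λ y∈xs py → All.lookup x∉ y∈xs (uni px py))))
  ... | no _   = ∑-𝟙-unique u uni

  -- Replaces membership by a sum over all of `xs`, so that later the order of a double sum can be
  -- exchanged.
  ∈⇒≤∑-𝟙 : ∀ {x xs} (f : A → ℕ) → x ∈ xs → P x → f x ≤ ∑[ y ← xs ] (𝟙 (P? y) * f y)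
  ∈⇒≤∑-𝟙 {x} {_ ∷ xs} f (here refl)  px = begin
    f x                                       ≡⟨ *-identityˡ (f x) ⟨
    1 * f x                                   ≡⟨ cong (_* f x) (𝟙-yes (P? x) px) ⟨
    𝟙 (P? x) * f x                            ≤⟨ m≤m+n _ _ ⟩
    ∑[ y ← x ∷ xs ] (𝟙 (P? y) * f y)          ∎
    where open ≤-Reasoning
  ∈⇒≤∑-𝟙 {x} {_ ∷ xs} f (there x∈xs) px =
    ≤-trans (∈⇒≤∑-𝟙 f x∈xs px) (m≤n+m _ _)

module _ (_≟_ : DecidableEquality A) where

  -- Each `f x` is bounded by a sum over `ys` that picks out the copies of `x`. After the exchange
  -- of sums each `f y` is counted at most once, because `xs` has no repetitions.
  ∑-⊆ : ∀ {xs ys : List A} → Unique xs → (∀ {x} → x ∈ xs → x ∈ ys) → ∀ f → ∑ xs f ≤ ∑ ys f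
  ∑-⊆ {xs} {ys} xs! xs⊆ys f = begin
    ∑ xs f                                             ≤⟨ ∑-mono-∈ xs (λ {x} x∈xs → ∈⇒≤∑-𝟙 (x ≟_) f (xs⊆ys x∈xs) refl) ⟩
    ∑[ x ← xs ] ∑[ y ← ys ] (𝟙 (x ≟ y) * f y)          ≡⟨ ∑-swap xs ys _ ⟩
    ∑[ y ← ys ] ∑[ x ← xs ] (𝟙 (x ≟ y) * f y)          ≡⟨ ∑-cong ys (λ y → ∑-*ʳ (f y) xs _) ⟩
    ∑[ y ← ys ] (∑[ x ← xs ] 𝟙 (x ≟ y)) * f y          ≤⟨ ∑-mono ys (λ y → *-monoˡ-≤ (f y)
                                                            (∑-𝟙-unique (_≟ y) xs! (λ p q → trans p (sym q)))) ⟩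
    ∑[ y ← ys ] 1 * f y                                ≡⟨ ∑-cong ys (λ y → *-identityˡ (f y)) ⟩
    ∑ ys f                                             ∎
    where open ≤-Reasoning

  Unique-⊆⇒length≤ : ∀ {xs ys : List A} → Unique xs → (∀ {x} → x ∈ xs → x ∈ ys) → length xs ≤ length ys
  Unique-⊆⇒length≤ {xs} {ys} xs! xs⊆ys = subst₂ _≤_ (length-∑ xs) (length-∑ ys) (∑-⊆ xs! xs⊆ys (λ _ → 1))
    where
    length-∑ : ∀ zs → ∑[ _ ← zs ] 1 ≡ length zs
    length-∑ zs = trans (∑-const 1 zs) (*-identityʳ _)

-- Cauchy-Schwarz and the number of coincidences

2*m*n≤m²+n² : ∀ m n → 2 * (m * n) ≤ m * m + n * n
2*m*n≤m²+n² m n = [ ordered , (λ n≤m → subst₂ _≤_ (cong (2 *_) (*-comm n m)) (+-comm (n * n) (m * m)) (ordered n≤m)) ]′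
                    (≤-total m n)
  where
  square : ∀ m k → 2 * (m * (m + k)) + k * k ≡ m * m + (m + k) * (m + k)
  square = solve-∀
  ordered : ∀ {m n} → m ≤ n → 2 * (m * n) ≤ m * m + n * n
  -- For `n = m + k` the two sides differ by exactly `k²`.
  ordered {m} {n} m≤n = subst (λ n → 2 * (m * n) ≤ m * m + n * n) (m+[n∸m]≡n m≤n)
    (≤-trans (m≤m+n _ ((n ∸ m) * (n ∸ m))) (≤-reflexive (square m (n ∸ m))))

private
  m*[m*n]≡n*[m*m] : ∀ m n → m * (m * n) ≡ n * (m * m)
  m*[m*n]≡n*[m*m] = solve-∀

  m*n*o*o≡m*[n*[o*o]] : ∀ m n o → m * n * o * o ≡ m * (n * (o * o))
  m*n*o*o≡m*[n*[o*o]] = solve-∀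

  m*[n*o]≡n*[m*o] : ∀ m n o → m * (n * o) ≡ n * (m * o)
  m*[n*o]≡n*[m*o] = solve-∀

  regroup : ∀ n p e M K → n * (p * (e * M)) + K * (n * (e * e)) ≡ (p * n * M + K * n * e) * e
  regroup = solve-∀

-- Expand the square into a double sum and apply `2ab ≤ a² + b²` to each term: the two halves add up
-- to `length xs * S` each. Doubling both sides avoids division.
cauchy-schwarz : ∀ (xs : List A) f → ∑ xs f * ∑ xs f ≤ length xs * (∑[ x ← xs ] f x * f x)
cauchy-schwarz xs f = *-cancelˡ-≤ 2 (begin
  2 * (∑ xs f * ∑ xs f)                                   ≡⟨ cong (2 *_) (∑-*-∑ xs xs f f) ⟩
  2 * (∑[ x ← xs ] ∑[ y ← xs ] (f x * f y))               ≡⟨ ∑-*ˡ 2 xs _ ⟨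
  ∑[ x ← xs ] 2 * (∑[ y ← xs ] (f x * f y))               ≡⟨ ∑-cong xs (λ x → sym (∑-*ˡ 2 xs _)) ⟩
  ∑[ x ← xs ] ∑[ y ← xs ] 2 * (f x * f y)                 ≤⟨ ∑-mono xs (λ x → ∑-mono xs (λ y → 2*m*n≤m²+n² (f x) (f y))) ⟩
  ∑[ x ← xs ] ∑[ y ← xs ] (f x * f x + f y * f y)         ≡⟨ ∑-cong xs (λ x → ∑-+ xs _ _) ⟩
  ∑[ x ← xs ] ((∑[ y ← xs ] f x * f x) + S)               ≡⟨ ∑-+ xs _ _ ⟩
  (∑[ x ← xs ] ∑[ y ← xs ] f x * f x) + (∑[ x ← xs ] S)   ≡⟨ cong₂ _+_ (trans (∑-swap xs xs _) (∑-const S xs)) (∑-const S xs) ⟩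
  length xs * S + length xs * S                           ≡⟨ cong (length xs * S +_) (sym (+-identityʳ _)) ⟩
  2 * (length xs * S)                                     ∎)
  where
  open ≤-Reasoning
  S = ∑[ x ← xs ] (f x * f x)

module _ (_≟_ : DecidableEquality C) where

  -- Ordered pairs are counted, the diagonal included, so this is the sum of the squared fibre sizes
  -- of `g`.
  collisions : (A → C) → List A → ℕ
  collisions g xs = ∑[ x ← xs ] ∑[ y ← xs ] 𝟙 (g x ≟ g y)

  -- Cauchy-Schwarz for the fibre sizes of `g` over `ts`: they add up to at least `length xs`, and
  -- their squares to at most the number of collisions.
  length²≤collisions : ∀ (g : A → C) xs {ts} → Unique ts → (∀ {x} → x ∈ xs → g x ∈ ts) →
                       length xs * length xs ≤ length ts * collisions g xs
  length²≤collisions g xs {ts} ts! g∈ts = begin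
    length xs * length xs                        ≤⟨ *-mono-≤ length≤ length≤ ⟩
    ∑ ts fibre * ∑ ts fibre                      ≤⟨ cauchy-schwarz ts fibre ⟩
    length ts * (∑[ t ← ts ] fibre t * fibre t)  ≤⟨ *-monoʳ-≤ (length ts) fibres≤ ⟩
    length ts * collisions g xs                  ∎
    where
    open ≤-Reasoning
    fibre : C → ℕ
    fibre t = ∑[ x ← xs ] 𝟙 (g x ≟ t)

    length≤ : length xs ≤ ∑ ts fibre
    length≤ = begin
      length xs                                  ≡⟨ trans (∑-const 1 xs) (*-identityʳ _) ⟨
      ∑[ _ ← xs ] 1                              ≤⟨ ∑-mono-∈ xs (λ {x} x∈xs → ∈⇒≤∑-𝟙 (g x ≟_) (λ _ → 1) (g∈ts x∈xs) refl) ⟩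
      ∑[ x ← xs ] ∑[ t ← ts ] 𝟙 (g x ≟ t) * 1    ≡⟨ ∑-cong xs (λ x → ∑-cong ts (λ t → *-identityʳ _)) ⟩
      ∑[ x ← xs ] ∑[ t ← ts ] 𝟙 (g x ≟ t)        ≡⟨ ∑-swap xs ts _ ⟩
      ∑ ts fibre                                 ∎

    -- One factor `𝟙 (s ≟ t)` is kept on the right, so that the sum over the distinct entries `t` of
    -- `ts` stays at most 1.
    𝟙*𝟙≤ : ∀ s s′ t → 𝟙 (s ≟ t) * 𝟙 (s′ ≟ t) ≤ 𝟙 (s ≟ s′) * 𝟙 (s ≟ t)
    𝟙*𝟙≤ s s′ t with s ≟ t | s′ ≟ t
    ... | no _     | _        = z≤n
    ... | yes _    | no _     = z≤n
    ... | yes refl | yes refl = ≤-reflexive (sym (cong (_* 1) (𝟙-yes (t ≟ t) refl)))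

    common≤ : ∀ s s′ → ∑[ t ← ts ] (𝟙 (s ≟ t) * 𝟙 (s′ ≟ t)) ≤ 𝟙 (s ≟ s′)
    common≤ s s′ = begin
      ∑[ t ← ts ] (𝟙 (s ≟ t) * 𝟙 (s′ ≟ t))   ≤⟨ ∑-mono ts (𝟙*𝟙≤ s s′) ⟩
      ∑[ t ← ts ] (𝟙 (s ≟ s′) * 𝟙 (s ≟ t))   ≡⟨ ∑-*ˡ (𝟙 (s ≟ s′)) ts _ ⟩
      𝟙 (s ≟ s′) * (∑[ t ← ts ] 𝟙 (s ≟ t))   ≤⟨ *-monoʳ-≤ (𝟙 (s ≟ s′)) (∑-𝟙-unique (s ≟_) ts! (λ p q → trans (sym p) q)) ⟩
      𝟙 (s ≟ s′) * 1                         ≡⟨ *-identityʳ _ ⟩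
      𝟙 (s ≟ s′)                             ∎

    fibres≤ : ∑[ t ← ts ] (fibre t * fibre t) ≤ collisions g xs
    fibres≤ = begin
      ∑[ t ← ts ] (fibre t * fibre t)                                          ≡⟨ ∑-cong ts (λ t → ∑-*-∑ xs xs _ _) ⟩
      ∑[ t ← ts ] ∑[ x ← xs ] ∑[ y ← xs ] (𝟙 (g x ≟ t) * 𝟙 (g y ≟ t))          ≡⟨ ∑-swap ts xs _ ⟩
      ∑[ x ← xs ] ∑[ t ← ts ] ∑[ y ← xs ] (𝟙 (g x ≟ t) * 𝟙 (g y ≟ t))          ≡⟨ ∑-cong xs (λ x → ∑-swap ts xs _) ⟩
      ∑[ x ← xs ] ∑[ y ← xs ] ∑[ t ← ts ] (𝟙 (g x ≟ t) * 𝟙 (g y ≟ t))          ≤⟨ ∑-mono xs (λ x → ∑-mono xs (λ y → common≤ (g x) (g y))) ⟩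
      collisions g xs                                                          ∎

-- Natural numbers as rationals, and the order of the reals

natℚ : ℕ → ℚ
natℚ n = ℤ.+ n ℚ./ 1

-- Division by 1 normalises with a gcd that is stuck on a variable numerator. Among unnormalised
-- fractions the same facts become facts about integers.
toℚᵘ-natℚ : ∀ n → toℚᵘ (natℚ n) ℚᵘ.≃ mkℚᵘ (ℤ.+ n) 0
toℚᵘ-natℚ n = ℚ.toℚᵘ-fromℚᵘ (mkℚᵘ (ℤ.+ n) 0)

natℚ-+ : ∀ m n → natℚ (m + n) ≡ natℚ m ℚ.+ natℚ n
natℚ-+ m n = ℚ.toℚᵘ-injective (begin-equality
  toℚᵘ (natℚ (m + n))                     ≃⟨ toℚᵘ-natℚ (m + n) ⟩
  mkℚᵘ (ℤ.+ (m + n)) 0                  ≃⟨ *≡* (cong (ℤ._* ℤ.+ 1) (cong₂ ℤ._+_ (sym (ℤ.*-identityʳ (ℤ.+ m))) (sym (ℤ.*-identityʳ (ℤ.+ n))))) ⟩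
  mkℚᵘ (ℤ.+ m) 0 ℚᵘ.+ mkℚᵘ (ℤ.+ n) 0      ≃⟨ ℚᵘ.+-cong (toℚᵘ-natℚ m) (toℚᵘ-natℚ n) ⟨
  toℚᵘ (natℚ m) ℚᵘ.+ toℚᵘ (natℚ n)        ≃⟨ ℚ.toℚᵘ-homo-+ (natℚ m) (natℚ n) ⟨
  toℚᵘ (natℚ m ℚ.+ natℚ n)                ∎)
  where open ℚᵘ.≤-Reasoning

natℚ-* : ∀ m n → natℚ (m * n) ≡ natℚ m ℚ.* natℚ n
natℚ-* m n = ℚ.toℚᵘ-injective (begin-equality
  toℚᵘ (natℚ (m * n))                     ≃⟨ toℚᵘ-natℚ (m * n) ⟩
  mkℚᵘ (ℤ.+ (m * n)) 0                  ≃⟨ *≡* (cong (ℤ._* ℤ.+ 1) (ℤ.pos-* m n)) ⟩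
  mkℚᵘ (ℤ.+ m) 0 ℚᵘ.* mkℚᵘ (ℤ.+ n) 0      ≃⟨ ℚᵘ.*-cong (toℚᵘ-natℚ m) (toℚᵘ-natℚ n) ⟨
  toℚᵘ (natℚ m) ℚᵘ.* toℚᵘ (natℚ n)        ≃⟨ ℚ.toℚᵘ-homo-* (natℚ m) (natℚ n) ⟨
  toℚᵘ (natℚ m ℚ.* natℚ n)                ∎)
  where open ℚᵘ.≤-Reasoning

natℚ-mono-≤ : ∀ {m n} → m ≤ n → natℚ m ℚ.≤ natℚ n
natℚ-mono-≤ {m} {n} m≤n = ℚ.toℚᵘ-cancel-≤ (begin
  toℚᵘ (natℚ m)      ≃⟨ toℚᵘ-natℚ m ⟩
  mkℚᵘ (ℤ.+ m) 0     ≤⟨ *≤* (ℤ.*-monoʳ-≤-nonNeg (ℤ.+ 1) (ℤ.+≤+ m≤n)) ⟩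
  mkℚᵘ (ℤ.+ n) 0     ≃⟨ toℚᵘ-natℚ n ⟨
  toℚᵘ (natℚ n)      ∎)
  where open ℚᵘ.≤-Reasoning

0≤natℚ : ∀ n → 0ℚ ℚ.≤ natℚ n
0≤natℚ n = natℚ-mono-≤ (z≤n {n})

0<natℚ-suc : ∀ n → 0ℚ ℚ.< natℚ (suc n)
0<natℚ-suc n = ℚ.positive⁻¹ _ {{ℚ.normalize-pos (suc n) 1}}

<ᵣ⇒≤ᵣ : ∀ {x y} → x <ᵣ y → x ≤ᵣ y
<ᵣ⇒≤ᵣ {x} {y} (δ , 0<δ , M , x+δ≤y) ε 0<ε = M , λ n M≤n → begin
  seq x n             ≡⟨ ℚ.+-identityʳ _ ⟨
  seq x n ℚ.+ 0ℚ      ≤⟨ ℚ.+-monoʳ-≤ (seq x n) (ℚ.<⇒≤ 0<δ) ⟩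
  seq x n ℚ.+ δ       ≤⟨ x+δ≤y n M≤n ⟩
  seq y n             ≡⟨ ℚ.+-identityʳ _ ⟨
  seq y n ℚ.+ 0ℚ      ≤⟨ ℚ.+-monoʳ-≤ (seq y n) (ℚ.<⇒≤ 0<ε) ⟩
  seq y n ℚ.+ ε       ∎
  where open ℚ.≤-Reasoning

-- From integer inequalities to quotients of reals

private
  module Identities where
    open ℚ.+-*-Solver

    split-product : ∀ k q x e → k ℚ.* ((q ℚ.- x) ℚ.* e) ≡ k ℚ.* q ℚ.* e ℚ.- k ℚ.* x ℚ.* e
    split-product = solve 4 (λ k q x e → k :* ((q :- x) :* e) := k :* q :* e :- k :* x :* e) refl

    collect : ∀ b n m k e → b ℚ.* n ℚ.* m ℚ.+ k ℚ.* n ℚ.* e ≡ (b ℚ.* m ℚ.+ k ℚ.* e) ℚ.* n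
    collect = solve 5 (λ b n m k e → b :* n :* m :+ k :* n :* e := (b :* m :+ k :* e) :* n) refl

    separate : ∀ b m k e x δ → (b ℚ.* m ℚ.+ k ℚ.* e) ℚ.* (x ℚ.+ δ) ℚ.- k ℚ.* x ℚ.* e ≡
               b ℚ.* x ℚ.* m ℚ.+ (b ℚ.* m ℚ.+ k ℚ.* e) ℚ.* δ
    separate = solve 6 (λ b m k e x δ → (b :* m :+ k :* e) :* (x :+ δ) :- k :* x :* e :=
                 b :* x :* m :+ (b :* m :+ k :* e) :* δ) refl

    distribute : ∀ b x m ε y r → (b ℚ.* x ℚ.* m ℚ.+ ε ℚ.* y) ℚ.* r ≡ b ℚ.* x ℚ.* r ℚ.* m ℚ.+ ε ℚ.* (y ℚ.* r)
    distribute = solve 6 (λ b x m ε y r → (b :* x :* m :+ ε :* y) :* r := b :* x :* r :* m :+ ε :* (y :* r)) refl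

    cancel-scale : ∀ c a i → c ℚ.* (a ℚ.* i) ≡ a ℚ.* (c ℚ.* i)
    cancel-scale = solve 3 (λ c a i → c :* (a :* i) := a :* (c :* i)) refl

open Identities

-- Multiply by the reciprocal of `y`. The product on the right is bracketed like the terms of the
-- real quotient times `M`, so the conclusion applies to those terms directly.
≤-quotient : ∀ {k b x m ε y} → 0ℚ ℚ.< y → k ℚ.* y ℚ.≤ b ℚ.* x ℚ.* m ℚ.+ ε ℚ.* y →
             k ℚ.≤ b ℚ.* x ℚ.* recipℚ y ℚ.* m ℚ.+ ε
≤-quotient {k} {b} {x} {m} {ε} {y} 0<y ky≤ = begin
  k                                          ≡⟨ ℚ.*-identityʳ k ⟨
  k ℚ.* 1ℚ                                   ≡⟨ cong (k ℚ.*_) yr≡1 ⟨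
  k ℚ.* (y ℚ.* r)                            ≡⟨ ℚ.*-assoc k y r ⟨
  k ℚ.* y ℚ.* r                              ≤⟨ ℚ.*-monoʳ-≤-nonNeg r {{ℚ.nonNegative (recipℚ-nonNeg y (ℚ.<⇒≤ 0<y))}} ky≤ ⟩
  (b ℚ.* x ℚ.* m ℚ.+ ε ℚ.* y) ℚ.* r          ≡⟨ distribute b x m ε y r ⟩
  b ℚ.* x ℚ.* r ℚ.* m ℚ.+ ε ℚ.* (y ℚ.* r)    ≡⟨ cong (λ z → b ℚ.* x ℚ.* r ℚ.* m ℚ.+ ε ℚ.* z) yr≡1 ⟩
  b ℚ.* x ℚ.* r ℚ.* m ℚ.+ ε ℚ.* 1ℚ           ≡⟨ cong (b ℚ.* x ℚ.* r ℚ.* m ℚ.+_) (ℚ.*-identityʳ ε) ⟩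
  b ℚ.* x ℚ.* r ℚ.* m ℚ.+ ε                  ∎
  where
  open ℚ.≤-Reasoning
  r = recipℚ y
  yr≡1 : y ℚ.* r ≡ 1ℚ
  yr≡1 = recipℚ-inverse y (λ y≡0 → ℚ.<⇒≢ 0<y (sym y≡0))

-- In use, `n` is an integer below a real number, `x` a term of that real and `δ` the error.
-- Replacing `n` by `x + δ` and subtracting `k x e` turns the factor `q` into `q - x`, at the cost
-- of `c δ`.
approximate-bound : ∀ {k q b n m e x δ} → 0ℚ ℚ.≤ b ℚ.* m ℚ.+ k ℚ.* e → n ℚ.≤ x ℚ.+ δ →
  k ℚ.* q ℚ.* e ℚ.≤ b ℚ.* n ℚ.* m ℚ.+ k ℚ.* n ℚ.* e →
  k ℚ.* ((q ℚ.- x) ℚ.* e) ℚ.≤ b ℚ.* x ℚ.* m ℚ.+ (b ℚ.* m ℚ.+ k ℚ.* e) ℚ.* δ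
approximate-bound {k} {q} {b} {n} {m} {e} {x} {δ} 0≤c n≤x+δ bound = begin
  k ℚ.* ((q ℚ.- x) ℚ.* e)                               ≡⟨ split-product k q x e ⟩
  k ℚ.* q ℚ.* e ℚ.- k ℚ.* x ℚ.* e                       ≤⟨ ℚ.+-monoˡ-≤ _ bound ⟩
  b ℚ.* n ℚ.* m ℚ.+ k ℚ.* n ℚ.* e ℚ.- k ℚ.* x ℚ.* e     ≡⟨ cong (ℚ._- k ℚ.* x ℚ.* e) (collect b n m k e) ⟩
  c ℚ.* n ℚ.- k ℚ.* x ℚ.* e                             ≤⟨ ℚ.+-monoˡ-≤ _ (ℚ.*-monoˡ-≤-nonNeg c {{ℚ.nonNegative 0≤c}} n≤x+δ) ⟩
  c ℚ.* (x ℚ.+ δ) ℚ.- k ℚ.* x ℚ.* e                     ≡⟨ separate b m k e x δ ⟩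
  b ℚ.* x ℚ.* m ℚ.+ c ℚ.* δ                             ∎
  where
  open ℚ.≤-Reasoning
  c = b ℚ.* m ℚ.+ k ℚ.* e

-- n ≤ N only gives n ≤ seq N i + δ for large i; δ is chosen so that the resulting error
-- (B M + K e) δ is at most ε η, where η is an eventual lower bound of the denominator y.
≤ᵣ-quotient : ∀ {K q e B M n} N (0<y : fromℕ 0 <ᵣ ((fromℕ q -ᵣ N) *ᵣ fromℕ e)) → fromℕ n ≤ᵣ N →
  K * q * e ≤ B * n * M + K * n * e →
  fromℕ K ≤ᵣ (((fromℕ B *ᵣ N) /ᵣ ((fromℕ q -ᵣ N) *ᵣ fromℕ e) [ 0<y ]) *ᵣ fromℕ M)
≤ᵣ-quotient {K} {q} {e} {B} {M} {n} N (η , 0<η , L , η≤y) n≤N bound ε 0<ε =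
  L ⊔ proj₁ near , λ i i≥ → ≤-quotient {b = natℚ B} {x = seq N i} {m = natℚ M} (0<y i (ℕ.m⊔n≤o⇒m≤o L _ i≥)) (begin
    natℚ K ℚ.* y i                               ≤⟨ approximate-bound {natℚ K} {natℚ q} {natℚ B} {natℚ n} {natℚ M} {natℚ e} {seq N i} {δ}
                                                      0≤c (proj₂ near i (ℕ.m⊔n≤o⇒n≤o L _ i≥)) boundℚ ⟩
    natℚ B ℚ.* seq N i ℚ.* natℚ M ℚ.+ c ℚ.* δ    ≤⟨ ℚ.+-monoʳ-≤ (natℚ B ℚ.* seq N i ℚ.* natℚ M) (cδ≤ i (ℕ.m⊔n≤o⇒m≤o L _ i≥)) ⟩
    natℚ B ℚ.* seq N i ℚ.* natℚ M ℚ.+ ε ℚ.* y i  ∎)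
  where
  open ℚ.≤-Reasoning
  y : ℕ → ℚ
  y i = (natℚ q ℚ.- seq N i) ℚ.* natℚ e
  η≤y′ : ∀ i → L ≤ i → η ℚ.≤ y i
  η≤y′ i L≤i = subst (ℚ._≤ y i) (ℚ.+-identityˡ η) (η≤y i L≤i)
  0<y : ∀ i → L ≤ i → 0ℚ ℚ.< y i
  0<y i L≤i = ℚ.<-≤-trans 0<η (η≤y′ i L≤i)
  c₀ = B * M + K * e
  c = natℚ B ℚ.* natℚ M ℚ.+ natℚ K ℚ.* natℚ e
  c≡natℚ-c₀ : natℚ c₀ ≡ c
  c≡natℚ-c₀ = trans (natℚ-+ (B * M) (K * e)) (cong₂ ℚ._+_ (natℚ-* B M) (natℚ-* K e))
  0≤c : 0ℚ ℚ.≤ c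
  0≤c = subst (0ℚ ℚ.≤_) c≡natℚ-c₀ (0≤natℚ c₀)
  -- The successor makes `s` invertible even if `c₀` is 0, and `s` still bounds `c` from above.
  s = natℚ (suc c₀)
  instance
    s-positive : ℚ.Positive s
    s-positive = ℚ.positive (0<natℚ-suc c₀)
    s-nonZero : ℚ.NonZero s
    s-nonZero = ℚ.pos⇒nonZero s
  εη-positive : ℚ.Positive (ε ℚ.* η)
  εη-positive = ℚ.pos*pos⇒pos ε {{ℚ.positive 0<ε}} η {{ℚ.positive 0<η}}
  δ : ℚ
  δ = ε ℚ.* η ℚ.* 1/ s
  0<δ : 0ℚ ℚ.< δ
  0<δ = ℚ.positive⁻¹ δ {{ℚ.pos*pos⇒pos (ε ℚ.* η) {{εη-positive}} (1/ s) {{ℚ.1/pos⇒pos s}}}}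
  near = n≤N δ 0<δ
  cδ≤ : ∀ i → L ≤ i → c ℚ.* δ ℚ.≤ ε ℚ.* y i
  cδ≤ i L≤i = begin
    c ℚ.* δ                       ≤⟨ ℚ.*-monoʳ-≤-nonNeg δ {{ℚ.nonNegative (ℚ.<⇒≤ 0<δ)}}
                                       (subst (ℚ._≤ s) c≡natℚ-c₀ (natℚ-mono-≤ (ℕ.n≤1+n c₀))) ⟩
    s ℚ.* δ                       ≡⟨ cancel-scale s (ε ℚ.* η) (1/ s) ⟩
    ε ℚ.* η ℚ.* (s ℚ.* 1/ s)      ≡⟨ cong (ε ℚ.* η ℚ.*_) (ℚ.*-inverseʳ s) ⟩
    ε ℚ.* η ℚ.* 1ℚ                ≡⟨ ℚ.*-identityʳ (ε ℚ.* η) ⟩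
    ε ℚ.* η                       ≤⟨ ℚ.*-monoˡ-≤-nonNeg ε {{ℚ.nonNegative (ℚ.<⇒≤ 0<ε)}} (η≤y′ i L≤i) ⟩
    ε ℚ.* y i                     ∎
  boundℚ : natℚ K ℚ.* natℚ q ℚ.* natℚ e ℚ.≤ natℚ B ℚ.* natℚ n ℚ.* natℚ M ℚ.+ natℚ K ℚ.* natℚ n ℚ.* natℚ e
  boundℚ = subst₂ ℚ._≤_ (triple K q e)
    (trans (natℚ-+ (B * n * M) _) (cong₂ ℚ._+_ (triple B n M) (triple K n e)))
    (natℚ-mono-≤ bound)
    where
    triple : ∀ a b c → natℚ (a * b * c) ≡ natℚ a ℚ.* natℚ b ℚ.* natℚ c
    triple a b c = trans (natℚ-* (a * b) c) (cong (ℚ._* natℚ c) (natℚ-* a b))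

-- Arithmetic of the field

module FiniteFieldGeometry {q : ℕ} (F : FiniteField q) where

  open Geometry F

  private
    field-ring : CommutativeRing 0ℓ 0ℓ
    field-ring = record { isCommutativeRing = isCommutativeRing }
      where open Apartness.IsHeytingField isHeytingField

  open CommutativeRing field-ring using (+-group; +-abelianGroup; ring)
    renaming ( +-assoc to ⊕-assoc; +-comm to ⊕-comm; +-identityʳ to ⊕-identityʳ
             ; -‿inverseˡ to ⊖-inverseˡ
             ; *-assoc to ⊗-assoc; *-comm to ⊗-comm; *-identityˡ to ⊗-identityˡ; *-identityʳ to ⊗-identityʳ
             ; zeroˡ to ⊗-zeroˡ; zeroʳ to ⊗-zeroʳ; distribˡ to ⊗-distribˡ-⊕; distribʳ to ⊗-distribʳ-⊕ )
  open Apartness.IsHeytingField isHeytingField using (#⇒invertible; invertible⇒#)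
  open GroupProperties +-group using (ε⁻¹≈ε) renaming (∙-cancelʳ to ⊕-cancelʳ)
  open AbelianGroupProperties +-abelianGroup using (xyx⁻¹≈y)
  open RingProperties ring using (-‿distribˡ-*)

  _≟ᶠ_ : DecidableEquality Carrier
  _≟ᶠ_ = via-injection (↔⇒↣ (↔-sym finite)) Fin._≟_

  infix 4 _≟ᶠ_ _≟ᵛ_

  _≟ᵛ_ : ∀ {d} → DecidableEquality (𝔽^ d)
  _≟ᵛ_ = Vec.≡-dec _≟ᶠ_

  -- The inverse is an argument because the field axioms supply inverses of differences `a ⊕ ⊖ b`.
  -- In this form the cancellation serves both differences and single nonzero elements.
  ⊗-cancelˡ-invertible : ∀ {a} → (∃ λ a⁻¹ → a⁻¹ ⊗ a ≡ 1# × a ⊗ a⁻¹ ≡ 1#) →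
                         ∀ {b c} → a ⊗ b ≡ a ⊗ c → b ≡ c
  ⊗-cancelˡ-invertible {a} (a⁻¹ , a⁻¹a≡1 , _) {b} {c} ab≡ac = begin
    b               ≡⟨ ⊗-identityˡ b ⟨
    1# ⊗ b          ≡⟨ cong (_⊗ b) a⁻¹a≡1 ⟨
    a⁻¹ ⊗ a ⊗ b     ≡⟨ ⊗-assoc a⁻¹ a b ⟩
    a⁻¹ ⊗ (a ⊗ b)   ≡⟨ cong (a⁻¹ ⊗_) ab≡ac ⟩
    a⁻¹ ⊗ (a ⊗ c)   ≡⟨ ⊗-assoc a⁻¹ a c ⟨
    a⁻¹ ⊗ a ⊗ c     ≡⟨ cong (_⊗ c) a⁻¹a≡1 ⟩
    1# ⊗ c          ≡⟨ ⊗-identityˡ c ⟩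
    c               ∎
    where open ≡-Reasoning

  ⊖0-identityʳ : ∀ a → a ⊕ ⊖ 0# ≡ a
  ⊖0-identityʳ a = trans (cong (a ⊕_) ε⁻¹≈ε) (⊕-identityʳ a)

  ≢0⇒invertible : ∀ {a} → a ≢ 0# → ∃ λ a⁻¹ → a⁻¹ ⊗ a ≡ 1# × a ⊗ a⁻¹ ≡ 1#
  ≢0⇒invertible {a} a≢0 =
    subst (λ b → ∃ λ a⁻¹ → a⁻¹ ⊗ b ≡ 1# × b ⊗ a⁻¹ ≡ 1#) (⊖0-identityʳ a) (#⇒invertible a≢0)

  ⊗-cancelˡ : ∀ {a b c} → a ≢ 0# → a ⊗ b ≡ a ⊗ c → b ≡ c
  ⊗-cancelˡ a≢0 = ⊗-cancelˡ-invertible (≢0⇒invertible a≢0)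

  1≢0 : 1# ≢ 0#
  1≢0 = invertible⇒# (1# , trans (⊗-identityˡ _) (⊖0-identityʳ 1#) , trans (⊗-identityʳ _) (⊖0-identityʳ 1#))

  -- Both equations reduce to one of the form `(a ⊕ ⊖ b) ⊗ c ≡ l ⊕ ⊖ k`, and the difference of the
  -- slopes is invertible.
  intersecting-lines-unique : ∀ {a b k l c c′} → a ≢ b →
    a ⊗ c ⊕ k ≡ b ⊗ c ⊕ l → a ⊗ c′ ⊕ k ≡ b ⊗ c′ ⊕ l → c ≡ c′
  intersecting-lines-unique {a} {b} {k} {l} a≢b e e′ =
    ⊗-cancelˡ-invertible (#⇒invertible a≢b) (trans (solved _ e) (sym (solved _ e′)))
    where
    open ≡-Reasoning
    solved : ∀ c → a ⊗ c ⊕ k ≡ b ⊗ c ⊕ l → (a ⊕ ⊖ b) ⊗ c ≡ l ⊕ ⊖ k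
    solved c e = ⊕-cancelʳ k _ _ (begin
      (a ⊕ ⊖ b) ⊗ c ⊕ k             ≡⟨ cong (_⊕ k) (⊗-distribʳ-⊕ c a (⊖ b)) ⟩
      a ⊗ c ⊕ ⊖ b ⊗ c ⊕ k           ≡⟨ ⊕-assoc _ _ k ⟩
      a ⊗ c ⊕ (⊖ b ⊗ c ⊕ k)         ≡⟨ cong (a ⊗ c ⊕_) (⊕-comm _ k) ⟩
      a ⊗ c ⊕ (k ⊕ ⊖ b ⊗ c)         ≡⟨ ⊕-assoc _ k _ ⟨
      a ⊗ c ⊕ k ⊕ ⊖ b ⊗ c           ≡⟨ cong (_⊕ ⊖ b ⊗ c) e ⟩
      b ⊗ c ⊕ l ⊕ ⊖ b ⊗ c           ≡⟨ cong (b ⊗ c ⊕ l ⊕_) (-‿distribˡ-* b c) ⟨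
      b ⊗ c ⊕ l ⊕ ⊖ (b ⊗ c)         ≡⟨ xyx⁻¹≈y (b ⊗ c) l ⟩
      l                             ≡⟨ ⊕-identityʳ l ⟨
      l ⊕ 0#                        ≡⟨ cong (l ⊕_) (⊖-inverseˡ k) ⟨
      l ⊕ (⊖ k ⊕ k)                 ≡⟨ ⊕-assoc l (⊖ k) k ⟨
      l ⊕ ⊖ k ⊕ k                   ∎)

  -- Enumerations of the field, its vectors and its units

  elements-Unique : Unique elements
  elements-Unique = Unique.map⁺ (λ {i} {j} e → trans (sym (Inverse.strictlyInverseʳ finite i))
    (trans (cong (Inverse.from finite) e) (Inverse.strictlyInverseʳ finite j))) (Unique.allFin⁺ q)

  length-elements : length elements ≡ q
  length-elements = trans (length-map (Inverse.to finite) (allFin q)) (length-tabulate id)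

  vectors-Unique : ∀ d → Unique (vectors d)
  vectors-Unique zero    = [] ∷ []
  vectors-Unique (suc d) =
    Unique.cartesianProductWith⁺ _∷_ Vec.∷-injective elements-Unique (vectors-Unique d)

  ∑-elements-const : ∀ k → ∑[ _ ← elements ] k ≡ q * k
  ∑-elements-const k = trans (∑-const k elements) (cong (_* k) length-elements)

  ∑-vectors-suc : ∀ d f → ∑ (vectors (suc d)) f ≡ ∑[ c ← elements ] ∑[ v ← vectors d ] f (c ∷ v)
  ∑-vectors-suc d f = ∑-cartesianProductWith _∷_ elements (vectors d) f

  ∑-vectors-const : ∀ d k → ∑[ _ ← vectors d ] k ≡ q ^ d * k
  ∑-vectors-const zero    k = refl
  ∑-vectors-const (suc d) k = begin
    ∑[ _ ← vectors (suc d) ] k                 ≡⟨ ∑-vectors-suc d (λ _ → k) ⟩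
    ∑[ _ ← elements ] ∑[ _ ← vectors d ] k     ≡⟨ ∑-cong elements (λ _ → ∑-vectors-const d k) ⟩
    ∑[ _ ← elements ] q ^ d * k                ≡⟨ ∑-elements-const (q ^ d * k) ⟩
    q * (q ^ d * k)                            ≡⟨ *-assoc q (q ^ d) k ⟨
    q ^ suc d * k                              ∎
    where open ≡-Reasoning

  units : List Carrier
  units = filter (λ c → ¬? (c ≟ᶠ 0#)) elements

  units-Unique : Unique units
  units-Unique = Unique.filter⁺ (λ c → ¬? (c ≟ᶠ 0#)) elements-Unique

  ∈-units⁺ : ∀ {c} → c ≢ 0# → c ∈ units
  ∈-units⁺ c≢0 = ∈-filter⁺ (λ c → ¬? (c ≟ᶠ 0#)) (∈-elements _) c≢0

  ∈-units⁻ : ∀ {c} → c ∈ units → c ≢ 0#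
  ∈-units⁻ c∈ = proj₂ (∈-filter⁻ (λ c → ¬? (c ≟ᶠ 0#)) {xs = elements} c∈)

  0<length-units : 0 < length units
  0<length-units with units | ∈-units⁺ 1≢0
  ... | _ ∷ _ | _ = s≤s z≤n

  q≤1+length-units : q ≤ suc (length units)
  q≤1+length-units = subst (_≤ suc (length units)) length-elements
    (Unique-⊆⇒length≤ _≟ᶠ_ elements-Unique (λ {c} _ → covered c))
    where
    covered : ∀ c → c ∈ 0# ∷ units
    covered c with c ≟ᶠ 0#
    ... | yes c≡0 = here c≡0
    ... | no  c≢0 = there (∈-units⁺ c≢0)

  -- Counting vectors on a hyperplane

  ⊕-shift : ∀ a b s → a ⊕ b ⊕ s ≡ b ⊕ (a ⊕ s)
  ⊕-shift a b s = trans (cong (_⊕ s) (⊕-comm a b)) (⊕-assoc b a s)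

  -- The offsets s and t absorb the contribution of the first coordinate in the induction.
  affine-hyperplane-≤ : ∀ {d} {x y : 𝔽^ d} → x ≢ y → ∀ s t →
    q * (∑[ v ← vectors d ] 𝟙 ((x ∙ v ⊕ s) ≟ᶠ (y ∙ v ⊕ t))) ≤ q ^ d
  affine-hyperplane-≤ {x = []}    {[]}    x≢y s t = contradiction refl x≢y
  affine-hyperplane-≤ {suc d} {a ∷ x} {b ∷ y} x≢y s t with x ≟ᵛ y
  -- The tails differ, so for each first coordinate `c` the induction hypothesis bounds the slice,
  -- with `a ⊗ c` and `b ⊗ c` moved into the offsets.
  ... | no x≢y′ = begin
    q * ∑ (vectors (suc d)) f                                  ≡⟨ cong (q *_) (∑-vectors-suc d f) ⟩
    q * (∑[ c ← elements ] ∑[ v ← vectors d ] f (c ∷ v))       ≡⟨ ∑-*ˡ q elements _ ⟨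
    ∑[ c ← elements ] q * (∑[ v ← vectors d ] f (c ∷ v))       ≤⟨ ∑-mono elements slice ⟩
    ∑[ c ← elements ] q ^ d                                    ≡⟨ ∑-elements-const (q ^ d) ⟩
    q ^ suc d                                                  ∎
    where
    open ≤-Reasoning
    f : 𝔽^ suc d → ℕ
    f v = 𝟙 (((a ∷ x) ∙ v ⊕ s) ≟ᶠ ((b ∷ y) ∙ v ⊕ t))
    slice : ∀ c → q * (∑[ v ← vectors d ] f (c ∷ v)) ≤ q ^ d
    slice c = ≤-trans
      (*-monoʳ-≤ q (∑-mono (vectors d) (λ v → 𝟙-mono (_ ≟ᶠ _) (_ ≟ᶠ _)
        (λ e → trans (sym (⊕-shift (a ⊗ c) (x ∙ v) s)) (trans e (⊕-shift (b ⊗ c) (y ∙ v) t))))))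
      (affine-hyperplane-≤ x≢y′ (a ⊗ c ⊕ s) (b ⊗ c ⊕ t))
  -- The tails agree, hence `a ≢ b`: for each fixed tail `v`, two lines of different slopes meet for
  -- at most one first coordinate `c`.
  ... | yes refl = begin
    q * ∑ (vectors (suc d)) f                                  ≡⟨ cong (q *_) (∑-vectors-suc d f) ⟩
    q * (∑[ c ← elements ] ∑[ v ← vectors d ] f (c ∷ v))       ≡⟨ cong (q *_) (∑-swap elements (vectors d) _) ⟩
    q * (∑[ v ← vectors d ] ∑[ c ← elements ] f (c ∷ v))       ≤⟨ *-monoʳ-≤ q (∑-mono (vectors d) slice) ⟩
    q * (∑[ v ← vectors d ] 1)                                 ≡⟨ cong (q *_) (∑-vectors-const d 1) ⟩
    q * (q ^ d * 1)                                            ≡⟨ cong (q *_) (*-identityʳ (q ^ d)) ⟩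
    q ^ suc d                                                  ∎
    where
    open ≤-Reasoning
    f : 𝔽^ suc d → ℕ
    f v = 𝟙 (((a ∷ x) ∙ v ⊕ s) ≟ᶠ ((b ∷ x) ∙ v ⊕ t))
    slice : ∀ v → ∑[ c ← elements ] f (c ∷ v) ≤ 1
    slice v = ∑-𝟙-unique (λ c → _ ≟ᶠ _) elements-Unique (λ e e′ →
      intersecting-lines-unique (λ a≡b → x≢y (cong (_∷ x) a≡b))
        (trans (sym (⊕-assoc _ _ s)) (trans e (⊕-assoc _ _ t)))
        (trans (sym (⊕-assoc _ _ s)) (trans e′ (⊕-assoc _ _ t))))

  -- For distinct vectors this is the affine bound with zero offsets. Equal vectors agree on every
  -- `v`, and `q ≤ 1 + length units` accounts for the last term. A single formula for both cases can
  -- be summed over all pairs of points.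
  hyperplane-≤ : ∀ {d} (x y : 𝔽^ d) →
    q * (∑[ v ← vectors d ] 𝟙 (x ∙ v ≟ᶠ y ∙ v)) ≤ q ^ d + length units * q ^ d * 𝟙 (x ≟ᵛ y)
  hyperplane-≤ {d} x y with x ≟ᵛ y
  ... | yes refl = begin
    q * (∑[ v ← vectors d ] 𝟙 (x ∙ v ≟ᶠ x ∙ v))     ≡⟨ cong (q *_) (∑-cong (vectors d) (λ v → 𝟙-yes (x ∙ v ≟ᶠ x ∙ v) refl)) ⟩
    q * (∑[ v ← vectors d ] 1)                      ≡⟨ cong (q *_) (trans (∑-vectors-const d 1) (*-identityʳ (q ^ d))) ⟩
    q * q ^ d                                       ≤⟨ *-monoˡ-≤ (q ^ d) q≤1+length-units ⟩
    q ^ d + length units * q ^ d                    ≡⟨ cong (q ^ d +_) (*-identityʳ _) ⟨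
    q ^ d + length units * q ^ d * 1                ∎
    where open ≤-Reasoning
  ... | no x≢y = ≤-trans
    (*-monoʳ-≤ q (∑-mono (vectors d) (λ v → 𝟙-mono (_ ≟ᶠ _) (_ ≟ᶠ _) (cong (_⊕ 0#)))))
    (≤-trans (affine-hyperplane-≤ x≢y 0# 0#) (m≤m+n _ _))

  -- Dot products, scalar multiples and the last coordinate

  ∙-distribʳ : ∀ {d} (x y z : 𝔽^ d) → (x +ᵥ y) ∙ z ≡ x ∙ z ⊕ y ∙ z
  ∙-distribʳ []      []      []      = sym (⊕-identityʳ 0#)
  ∙-distribʳ (a ∷ x) (b ∷ y) (c ∷ z) = begin
    (a ⊕ b) ⊗ c ⊕ (x +ᵥ y) ∙ z             ≡⟨ cong₂ _⊕_ (⊗-distribʳ-⊕ c a b) (∙-distribʳ x y z) ⟩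
    a ⊗ c ⊕ b ⊗ c ⊕ (x ∙ z ⊕ y ∙ z)        ≡⟨ ⊕-assoc _ _ _ ⟩
    a ⊗ c ⊕ (b ⊗ c ⊕ (x ∙ z ⊕ y ∙ z))      ≡⟨ cong (a ⊗ c ⊕_) (trans (sym (⊕-assoc _ _ _)) (cong (_⊕ y ∙ z) (⊕-comm _ _))) ⟩
    a ⊗ c ⊕ (x ∙ z ⊕ b ⊗ c ⊕ y ∙ z)        ≡⟨ cong (a ⊗ c ⊕_) (⊕-assoc _ _ _) ⟩
    a ⊗ c ⊕ (x ∙ z ⊕ (b ⊗ c ⊕ y ∙ z))      ≡⟨ ⊕-assoc _ _ _ ⟨
    a ⊗ c ⊕ x ∙ z ⊕ (b ⊗ c ⊕ y ∙ z)        ∎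
    where open ≡-Reasoning

  ∙-·ᵥ : ∀ {d} (x : 𝔽^ d) c y → x ∙ (c ·ᵥ y) ≡ c ⊗ (x ∙ y)
  ∙-·ᵥ []      c []      = sym (⊗-zeroʳ c)
  ∙-·ᵥ (a ∷ x) c (b ∷ y) = trans
    (cong₂ _⊕_ (trans (sym (⊗-assoc a c b)) (trans (cong (_⊗ b) (⊗-comm a c)) (⊗-assoc c a b))) (∙-·ᵥ x c y))
    (sym (⊗-distribˡ-⊕ c (a ⊗ b) (x ∙ y)))

  ∙-zeroˡ : ∀ {d} (y : 𝔽^ d) → 0ᵥ ∙ y ≡ 0#
  ∙-zeroˡ []      = refl
  ∙-zeroˡ (b ∷ y) = trans (cong₂ _⊕_ (⊗-zeroˡ b) (∙-zeroˡ y)) (⊕-identityʳ 0#)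

  +ᵥ-identityʳ : ∀ {d} (x : 𝔽^ d) → x +ᵥ 0ᵥ ≡ x
  +ᵥ-identityʳ []      = refl
  +ᵥ-identityʳ (a ∷ x) = cong₂ _∷_ (⊕-identityʳ a) (+ᵥ-identityʳ x)

  ·ᵥ-zeroˡ : ∀ {d} (x : 𝔽^ d) → 0# ·ᵥ x ≡ 0ᵥ
  ·ᵥ-zeroˡ []      = refl
  ·ᵥ-zeroˡ (a ∷ x) = cong₂ _∷_ (⊗-zeroˡ a) (·ᵥ-zeroˡ x)

  ·ᵥ-identityˡ : ∀ {d} (x : 𝔽^ d) → 1# ·ᵥ x ≡ x
  ·ᵥ-identityˡ []      = refl
  ·ᵥ-identityˡ (a ∷ x) = cong₂ _∷_ (⊗-identityˡ a) (·ᵥ-identityˡ x)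

  ·ᵥ-assoc : ∀ {d} a b (x : 𝔽^ d) → (a ⊗ b) ·ᵥ x ≡ a ·ᵥ b ·ᵥ x
  ·ᵥ-assoc a b []      = refl
  ·ᵥ-assoc a b (c ∷ x) = cong₂ _∷_ (⊗-assoc a b c) (·ᵥ-assoc a b x)

  -- The recursion moves to the first nonzero coordinate of `x` and cancels there.
  ·ᵥ-cancelʳ : ∀ {d} {x : 𝔽^ d} {a b} → x ≢ 0ᵥ → a ·ᵥ x ≡ b ·ᵥ x → a ≡ b
  ·ᵥ-cancelʳ {x = []}    x≢0 e = contradiction refl x≢0
  ·ᵥ-cancelʳ {x = c ∷ x} {a} {b} x≢0 e with c ≟ᶠ 0#
  ... | yes refl = ·ᵥ-cancelʳ (λ x≡0 → x≢0 (cong (0# ∷_) x≡0)) (proj₂ (Vec.∷-injective e))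
  ... | no c≢0   = ⊗-cancelˡ c≢0 (trans (⊗-comm c a) (trans (proj₁ (Vec.∷-injective e)) (⊗-comm b c)))

  ∷ʳ0-·ᵥ : ∀ {m} c (w : 𝔽^ m) → c ·ᵥ (w ∷ʳ 0#) ≡ (c ·ᵥ w) ∷ʳ 0#
  ∷ʳ0-·ᵥ c w = trans (Vec.map-∷ʳ (c ⊗_) 0# w) (cong ((c ·ᵥ w) ∷ʳ_) (⊗-zeroʳ c))

  0ᵥ-∷ʳ : ∀ m → 0ᵥ {m} ∷ʳ 0# ≡ 0ᵥ
  0ᵥ-∷ʳ zero    = refl
  0ᵥ-∷ʳ (suc m) = cong (0# ∷_) (0ᵥ-∷ʳ m)

  -- Dot products with vectors of the hyperplane ignore the last coordinate, which moves the
  -- counting from `𝔽^ suc m` to `𝔽^ m`.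
  ∙-∷ʳ0 : ∀ {m} (x : 𝔽^ suc m) w → x ∙ (w ∷ʳ 0#) ≡ init x ∙ w
  ∙-∷ʳ0 x w with initLast x
  ... | x′ , t , refl = snoc x′ w t
    where
    snoc : ∀ {m} (x w : 𝔽^ m) t → (x ∷ʳ t) ∙ (w ∷ʳ 0#) ≡ x ∙ w
    snoc []      []      t = trans (⊕-identityʳ _) (⊗-zeroʳ t)
    snoc (a ∷ x) (b ∷ w) t = cong (a ⊗ b ⊕_) (snoc x w t)

  -- Nonzero multiples of pairwise non-proportional vectors

  NonProportional : ∀ {d} → 𝔽^ d → 𝔽^ d → Set
  NonProportional w w′ = ∀ {a b} → a ≢ 0# → b ≢ 0# → a ·ᵥ w ≢ b ·ᵥ w′

  multiples : ∀ {d} → 𝔽^ d → List (𝔽^ d)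
  multiples w = map (_·ᵥ w) units

  ∈-multiples⁻ : ∀ {d} {v w : 𝔽^ d} → v ∈ multiples w → ∃ λ c → c ≢ 0# × v ≡ c ·ᵥ w
  ∈-multiples⁻ v∈ with ∈-map⁻ (_·ᵥ _) v∈
  ... | c , c∈ , v≡ = c , ∈-units⁻ c∈ , v≡

  -- Within one list, distinct scalars give distinct multiples of a nonzero vector. An entry common
  -- to two lists would be a relation between nonzero multiples, which `NonProportional` excludes.
  concat-multiples-Unique : ∀ {d} {ws : List (𝔽^ d)} → All (_≢ 0ᵥ) ws → AllPairs NonProportional ws →
                            Unique (concat (map multiples ws))
  concat-multiples-Unique ws≢0 ws∦ = Unique.concat⁺
    (All.map⁺ (All.map (λ w≢0 → Unique.map⁺ (·ᵥ-cancelʳ w≢0) units-Unique) ws≢0))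
    (AllPairs.map⁺ (AllPairs.map disjoint ws∦))
    where
    disjoint : ∀ {w w′} → NonProportional w w′ → Disjoint (multiples w) (multiples w′)
    disjoint ∦ (v∈ , v∈′) with ∈-multiples⁻ v∈ | ∈-multiples⁻ v∈′
    ... | a , a≢0 , v≡ | b , b≢0 , v≡′ = ∦ a≢0 b≢0 (trans (sym v≡) v≡′)

  -- Energy and excess of a direction

  module _ {m : ℕ} {E : Pred (𝔽^ suc m) 0ℓ} (E? : Decidable E) where

    points : List (𝔽^ suc m)
    points = filter E? (vectors (suc m))

    -- For fixed `x`, the points that agree with `x` outside the last coordinate are determined by
    -- that coordinate, so their number is at most a fibre size.
    fibre-collisions-≤ : collisions _≟ᵛ_ init points ≤ # E? * maxFibreSize E?
    fibre-collisions-≤ = ≤-trans (∑-mono points fibre≤)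
      (≤-reflexive (∑-const (maxFibreSize E?) points))
      where
      open ≤-Reasoning
      fibre≤ : ∀ x → ∑[ y ← points ] 𝟙 (init x ≟ᵛ init y) ≤ maxFibreSize E?
      fibre≤ x = begin
        ∑[ y ← points ] 𝟙 (x′ ≟ᵛ init y)            ≡⟨ ∑-𝟙-filter sameFibre? points ⟩
        length (filter sameFibre? points)           ≤⟨ Unique-⊆⇒length≤ _≟ᵛ_ (Unique.filter⁺ sameFibre?
                                                         (Unique.filter⁺ E? (vectors-Unique (suc m)))) inFibre ⟩
        length (map (x′ ∷ʳ_) (filter (λ t → E? (x′ ∷ʳ t)) elements))
                                                    ≡⟨ length-map (x′ ∷ʳ_) (filter (λ t → E? (x′ ∷ʳ t)) elements) ⟩
        fibreSize E? x′                             ≤⟨ All.lookup (xs≤max 0 _) (∈-map⁺ (fibreSize E?) (∈-vectors x′)) ⟩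
        maxFibreSize E?                             ∎
        where
        x′ = init x
        sameFibre? : Decidable (λ y → x′ ≡ init y)
        sameFibre? y = x′ ≟ᵛ init y
        snoc : ∀ y → x′ ≡ init y → ∃ λ t → y ≡ x′ ∷ʳ t
        snoc y x′≡ = last y , trans (proj₂ (proj₂ (initLast y))) (cong (_∷ʳ last y) (sym x′≡))
        inFibre : ∀ {y} → y ∈ filter sameFibre? points →
                  y ∈ map (x′ ∷ʳ_) (filter (λ t → E? (x′ ∷ʳ t)) elements)
        inFibre {y} y∈ with ∈-filter⁻ sameFibre? {xs = points} y∈
        ... | y∈points , x′≡ with snoc y x′≡ | ∈-filter⁻ E? {xs = vectors (suc m)} y∈points
        ... | t , refl | _ , Ey = ∈-map⁺ (x′ ∷ʳ_) (∈-filter⁺ (λ t → E? (x′ ∷ʳ t)) (∈-elements t) Ey)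

    -- The second moment of the projection of `E` in the direction `w ∷ʳ 0#`, since `init x ∙ w` is
    -- `x ∙ (w ∷ʳ 0#)`.
    energy : 𝔽^ m → ℕ
    energy w = collisions _≟ᶠ_ (λ x → init x ∙ w) points

    private
      e M u : ℕ
      e = # E?
      M = maxFibreSize E?
      u = length units

    -- Double counting: for a fixed pair of points, `hyperplane-≤` bounds the number of `v` that
    -- fail to separate them. Its extra term occurs only for pairs in a common fibre, counted by
    -- `fibre-collisions-≤`.
    ∑-energy-≤ : q * ∑ (vectors m) energy ≤ q ^ m * (e * e) + u * q ^ m * (e * M)
    ∑-energy-≤ = begin
      q * (∑[ v ← vectors m ] ∑[ x ← points ] ∑[ y ← points ] same x y v)
        ≡⟨ cong (q *_) (trans (∑-swap (vectors m) points _) (∑-cong points (λ x → ∑-swap (vectors m) points _))) ⟩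
      q * (∑[ x ← points ] ∑[ y ← points ] ∑[ v ← vectors m ] same x y v)
        ≡⟨ trans (sym (∑-*ˡ q points _)) (∑-cong points (λ x → sym (∑-*ˡ q points _))) ⟩
      ∑[ x ← points ] ∑[ y ← points ] q * (∑[ v ← vectors m ] same x y v)
        ≤⟨ ∑-mono points (λ x → ∑-mono points (λ y → hyperplane-≤ (init x) (init y))) ⟩
      ∑[ x ← points ] ∑[ y ← points ] (q ^ m + u * q ^ m * 𝟙 (init x ≟ᵛ init y))
        ≡⟨ ∑-cong points (λ x → trans (∑-+ points _ _)
             (cong₂ _+_ (∑-const (q ^ m) points) (∑-*ˡ (u * q ^ m) points _))) ⟩
      ∑[ x ← points ] (e * q ^ m + u * q ^ m * (∑[ y ← points ] 𝟙 (init x ≟ᵛ init y)))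
        ≡⟨ trans (∑-+ points _ _) (cong₂ _+_ (∑-const (e * q ^ m) points) (∑-*ˡ (u * q ^ m) points _)) ⟩
      e * (e * q ^ m) + u * q ^ m * collisions _≟ᵛ_ init points
        ≤⟨ +-mono-≤ (≤-reflexive (m*[m*n]≡n*[m*m] e (q ^ m))) (*-monoʳ-≤ (u * q ^ m) fibre-collisions-≤) ⟩
      q ^ m * (e * e) + u * q ^ m * (e * M) ∎
      where
      open ≤-Reasoning
      same : 𝔽^ suc m → 𝔽^ suc m → 𝔽^ m → ℕ
      same x y v = 𝟙 (init x ∙ v ≟ᶠ init y ∙ v)

    -- In Fourier terms, the sum of the squared absolute values of the Fourier coefficients of `E`
    -- at the nonzero multiples of `w ∷ʳ 0#`. By `excess-+` the truncated subtraction loses nothing.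
    excess : 𝔽^ m → ℕ
    excess w = q * energy w ∸ e * e

    excess-+ : ∀ w → excess w + e * e ≡ q * energy w
    -- Nonnegativity is Cauchy-Schwarz with all `q` field elements as possible values.
    excess-+ w = m∸n+n≡m (subst (λ n → e * e ≤ n * energy w) length-elements
      (length²≤collisions _≟ᶠ_ (λ x → init x ∙ w) points elements-Unique (λ _ → ∈-elements _)))

    -- The terms `e * e`, summed over all `q ^ m` vectors, cancel the main term of `∑-energy-≤`
    -- exactly; only the fibre term remains.
    ∑-excess-≤ : ∑ (vectors m) excess ≤ u * q ^ m * (e * M)
    ∑-excess-≤ = +-cancelʳ-≤ (q ^ m * (e * e)) _ _ (begin
      ∑ (vectors m) excess + q ^ m * (e * e)         ≡⟨ cong (∑ (vectors m) excess +_) (∑-vectors-const m (e * e)) ⟨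
      ∑ (vectors m) excess + (∑[ _ ← vectors m ] e * e)
                                                     ≡⟨ ∑-+ (vectors m) _ _ ⟨
      ∑[ w ← vectors m ] (excess w + e * e)          ≡⟨ ∑-cong (vectors m) excess-+ ⟩
      ∑[ w ← vectors m ] q * energy w                ≡⟨ ∑-*ˡ q (vectors m) energy ⟩
      q * ∑ (vectors m) energy                       ≤⟨ ∑-energy-≤ ⟩
      q ^ m * (e * e) + u * q ^ m * (e * M)          ≡⟨ +-comm (q ^ m * (e * e)) _ ⟩
      u * q ^ m * (e * M) + q ^ m * (e * e)          ∎)
      where open ≤-Reasoning

    -- Scaling by a nonzero `c` multiplies all values of the functional by `c`, so the same pairs of
    -- points coincide.
    excess-·ᵥ : ∀ {c} → c ≢ 0# → ∀ w → excess (c ·ᵥ w) ≡ excess w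
    excess-·ᵥ {c} c≢0 w = cong (λ n → q * n ∸ e * e)
      (∑-cong points (λ x → ∑-cong points (λ y → ≤-antisym
        (𝟙-mono (_ ≟ᶠ _) (_ ≟ᶠ _) (λ eq → ⊗-cancelˡ c≢0
          (trans (sym (∙-·ᵥ (init x) c w)) (trans eq (∙-·ᵥ (init y) c w)))))
        (𝟙-mono (_ ≟ᶠ _) (_ ≟ᶠ _) (λ eq →
          trans (∙-·ᵥ (init x) c w) (trans (cong (c ⊗_) eq) (sym (∙-·ᵥ (init y) c w))))))))

    -- Each direction stands for `u` nonzero multiples of equal excess, and multiples of different
    -- directions are distinct vectors. Hence `u` times the sum is at most the sum over the whole
    -- space, and `u` cancels.
    ∑-excess-directions-≤ : ∀ {ws} → All (_≢ 0ᵥ) ws → AllPairs NonProportional ws →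
                            ∑ ws excess ≤ q ^ m * (e * M)
    ∑-excess-directions-≤ {ws} ws≢0 ws∦ = *-cancelˡ-≤ u {{>-nonZero 0<length-units}} (begin
      u * ∑ ws excess                          ≡⟨ ∑-*ˡ u ws excess ⟨
      ∑[ w ← ws ] u * excess w                   ≡⟨ ∑-cong ws ∑-multiples ⟨
      ∑[ w ← ws ] ∑ (multiples w) excess       ≡⟨ ∑-concat-map multiples ws excess ⟨
      ∑ (concat (map multiples ws)) excess     ≤⟨ ∑-⊆ _≟ᵛ_ (concat-multiples-Unique ws≢0 ws∦) (λ _ → ∈-vectors _) excess ⟩
      ∑ (vectors m) excess                     ≤⟨ ∑-excess-≤ ⟩
      u * q ^ m * (e * M)                           ≡⟨ *-assoc u (q ^ m) (e * M) ⟩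
      u * (q ^ m * (e * M))                         ∎)
      where
      open ≤-Reasoning
      ∑-multiples : ∀ w → ∑ (multiples w) excess ≡ u * excess w
      ∑-multiples w = trans (∑-map (_·ᵥ w) units excess)
        (trans (∑-cong-∈ units (λ c∈ → excess-·ᵥ (∈-units⁻ c∈) w)) (∑-const (excess w) units))

    -- The energy hypothesis gives `q e² ≤ n excess + n e²` for each direction; sum over `ws` and
    -- divide by `e`. The result is `K (q - n) e ≤ q^m n M`, arranged so that no subtraction occurs
    -- in `ℕ`.
    directions-≤ : ∀ {n ws} → 0 < e → All (_≢ 0ᵥ) ws → AllPairs NonProportional ws →
                   All (λ w → e * e ≤ n * energy w) ws →
                   length ws * q * e ≤ q ^ m * n * M + length ws * n * e
    directions-≤ {n} {ws} 0<e ws≢0 ws∦ energetic = *-cancelʳ-≤ _ _ e {{>-nonZero 0<e}} (begin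
      K * q * e * e                                     ≡⟨ m*n*o*o≡m*[n*[o*o]] K q e ⟩
      K * (q * (e * e))                                 ≡⟨ ∑-const (q * (e * e)) ws ⟨
      ∑[ w ← ws ] q * (e * e)                           ≤⟨ ∑-mono-∈ ws (λ w∈ → bound (All.lookup energetic w∈)) ⟩
      ∑[ w ← ws ] (n * excess w + n * (e * e))       ≡⟨ trans (∑-+ ws _ _) (cong₂ _+_ (∑-*ˡ n ws _) (∑-const _ ws)) ⟩
      n * ∑ ws excess + K * (n * (e * e))          ≤⟨ +-monoˡ-≤ _ (*-monoʳ-≤ n (∑-excess-directions-≤ ws≢0 ws∦)) ⟩
      n * (q ^ m * (e * M)) + K * (n * (e * e))         ≡⟨ regroup n (q ^ m) e M K ⟩
      (q ^ m * n * M + K * n * e) * e                   ∎)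
      where
      open ≤-Reasoning
      K = length ws
      bound : ∀ {w} → e * e ≤ n * energy w → q * (e * e) ≤ n * excess w + n * (e * e)
      bound {w} h = begin
        q * (e * e)                              ≤⟨ *-monoʳ-≤ q h ⟩
        q * (n * energy w)                    ≡⟨ m*[n*o]≡n*[m*o] q n (energy w) ⟩
        n * (q * energy w)                    ≡⟨ cong (n *_) (excess-+ w) ⟨
        n * (excess w + e * e)                ≡⟨ *-distribˡ-+ n (excess w) (e * e) ⟩
        n * excess w + n * (e * e)            ∎

  -- Lines in the hyperplane and their directions

  module _ {m : ℕ} where

    IsDirection : Pred (𝔽^ suc m) 0ℓ → 𝔽^ m → Set
    IsDirection V w = w ≢ 0ᵥ × V (w ∷ʳ 0#) × (∀ y → V y → ∃ λ c → y ≡ c ·ᵥ (w ∷ʳ 0#))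

    -- The point in which the line meets the hyperplane and the sphere is a nonzero multiple of the
    -- given generator, so it generates the line as well.
    direction : ∀ {V} → LinesMeeting 0# V → ∃ (IsDirection V)
    direction {V} ((_ , v , _ , _ , spans) , x , Vx , x≢0 , x∈π , _) with initLast x
    direction {V} ((_ , v , _ , _ , spans) , _ , Vx , x≢0 , refl , _) | w , _ , refl =
      w , (λ w≡0 → x≢0 (trans (cong (_∷ʳ 0#) w≡0) (0ᵥ-∷ʳ m))) , Vx , spans′
      where
      x = w ∷ʳ 0#
      spans′ : ∀ y → V y → ∃ λ c → y ≡ c ·ᵥ x
      spans′ y Vy with spans x Vx | spans y Vy
      ... | a , x≡av | b , y≡bv with ≢0⇒invertible (λ a≡0 → x≢0 (trans x≡av (trans (cong (_·ᵥ v) a≡0) (·ᵥ-zeroˡ v))))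
      ... | a⁻¹ , a⁻¹a≡1 , _ = b ⊗ a⁻¹ , (begin
        y                       ≡⟨ y≡bv ⟩
        b ·ᵥ v                  ≡⟨ cong (b ·ᵥ_) (·ᵥ-identityˡ v) ⟨
        b ·ᵥ 1# ·ᵥ v            ≡⟨ cong (λ c → b ·ᵥ c ·ᵥ v) a⁻¹a≡1 ⟨
        b ·ᵥ (a⁻¹ ⊗ a) ·ᵥ v     ≡⟨ cong (b ·ᵥ_) (·ᵥ-assoc a⁻¹ a v) ⟩
        b ·ᵥ a⁻¹ ·ᵥ a ·ᵥ v      ≡⟨ cong (λ z → b ·ᵥ a⁻¹ ·ᵥ z) x≡av ⟨
        b ·ᵥ a⁻¹ ·ᵥ x           ≡⟨ ·ᵥ-assoc b a⁻¹ x ⟨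
        (b ⊗ a⁻¹) ·ᵥ x          ∎)
        where open ≡-Reasoning

    -- The generator of `V` is `a⁻¹ b` times that of `V′`, hence lies in `V′`. The reverse inclusion
    -- comes from exchanging the two lines.
    proportional⇒⊆ : ∀ {V V′ w w′ a b} → IsSubspace V′ → IsDirection V w → IsDirection V′ w′ →
                     a ≢ 0# → a ·ᵥ w ≡ b ·ᵥ w′ → ∀ {y} → V y → V′ y
    proportional⇒⊆ {V′ = V′} {w} {w′} {a} {b} sub′ (_ , _ , spans) (_ , V′w′ , _) a≢0 aw≡bw′ {y} Vy
      with spans y Vy | ≢0⇒invertible a≢0
    ... | c , refl | a⁻¹ , a⁻¹a≡1 , _ = ·∈ c (subst V′ a⁻¹bw′≡w (·∈ a⁻¹ (·∈ b V′w′)))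
      where
      open IsSubspace sub′
      open ≡-Reasoning
      a⁻¹bw′≡w : a⁻¹ ·ᵥ b ·ᵥ (w′ ∷ʳ 0#) ≡ w ∷ʳ 0#
      a⁻¹bw′≡w = begin
        a⁻¹ ·ᵥ b ·ᵥ (w′ ∷ʳ 0#)     ≡⟨ cong (a⁻¹ ·ᵥ_) (∷ʳ0-·ᵥ b w′) ⟩
        a⁻¹ ·ᵥ ((b ·ᵥ w′) ∷ʳ 0#)   ≡⟨ cong (λ v → a⁻¹ ·ᵥ (v ∷ʳ 0#)) aw≡bw′ ⟨
        a⁻¹ ·ᵥ ((a ·ᵥ w) ∷ʳ 0#)    ≡⟨ cong (a⁻¹ ·ᵥ_) (∷ʳ0-·ᵥ a w) ⟨
        a⁻¹ ·ᵥ a ·ᵥ (w ∷ʳ 0#)      ≡⟨ ·ᵥ-assoc a⁻¹ a (w ∷ʳ 0#) ⟨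
        (a⁻¹ ⊗ a) ·ᵥ (w ∷ʳ 0#)     ≡⟨ cong (_·ᵥ (w ∷ʳ 0#)) a⁻¹a≡1 ⟩
        1# ·ᵥ (w ∷ʳ 0#)            ≡⟨ ·ᵥ-identityˡ (w ∷ʳ 0#) ⟩
        w ∷ʳ 0#                    ∎

    directions : ∀ {Vs} → All (LinesMeeting 0#) Vs → List (𝔽^ m)
    directions = All.reduce (proj₁ ∘ direction)

    length-directions : ∀ {Vs} (ls : All (LinesMeeting 0#) Vs) → length (directions ls) ≡ length Vs
    length-directions []       = refl
    length-directions (_ ∷ ls) = cong suc (length-directions ls)

    directions-≢0 : ∀ {Vs} (ls : All (LinesMeeting 0#) Vs) → All (_≢ 0ᵥ) (directions ls)
    directions-≢0 []       = []
    directions-≢0 (l ∷ ls) = proj₁ (proj₂ (direction l)) ∷ directions-≢0 ls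

    directions-NonProportional : ∀ {Vs} (ls : All (LinesMeeting 0#) Vs) → AllPairs (λ V V′ → ¬ (V ≐ V′)) Vs →
                                 AllPairs NonProportional (directions ls)
    directions-NonProportional []       []          = []
    directions-NonProportional (l ∷ ls) (V≢ ∷ Vs≢) = distinct ls V≢ ∷ directions-NonProportional ls Vs≢
      where
      distinct : ∀ {Vs} (ls : All (LinesMeeting 0#) Vs) → All (λ V′ → ¬ (_ ≐ V′)) Vs →
                 All (NonProportional (proj₁ (direction l))) (directions ls)
      distinct []        []          = []
      distinct (l′ ∷ ls) (V≢V′ ∷ V≢) =
        (λ a≢0 b≢0 aw≡bw′ → V≢V′
          ( proportional⇒⊆ (proj₁ (proj₁ l′)) (proj₂ (direction l)) (proj₂ (direction l′)) a≢0 aw≡bw′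
          , proportional⇒⊆ (proj₁ (proj₁ l)) (proj₂ (direction l′)) (proj₂ (direction l)) b≢0 (sym aw≡bw′)))
        ∷ distinct ls V≢

    -- Since `x` lies in its own coset, `x` is `y` plus a vector orthogonal to `u`. Read
    -- contrapositively, different values of the functional give different cosets.
    coset-∙-injective : ∀ {V : Pred (𝔽^ suc m) 0ℓ} {u} → V u → ∀ {x y} → Coset x (V ^⊥) ≐ Coset y (V ^⊥) → x ∙ u ≡ y ∙ u
    coset-∙-injective {V} {u} Vu {x} {y} (x⊆y , _)
      with x⊆y (0ᵥ , (λ z _ → ∙-zeroˡ z) , sym (+ᵥ-identityʳ x))
    ... | w , w⊥V , x≡y+w = begin
      x ∙ u             ≡⟨ cong (_∙ u) x≡y+w ⟩
      (y +ᵥ w) ∙ u      ≡⟨ ∙-distribʳ y w u ⟩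
      y ∙ u ⊕ w ∙ u     ≡⟨ cong (y ∙ u ⊕_) (w⊥V u Vu) ⟩
      y ∙ u ⊕ 0#        ≡⟨ ⊕-identityʳ (y ∙ u) ⟩
      y ∙ u             ∎
      where open ≡-Reasoning

    -- Few cosets force a large energy

    module _ {E : Pred (𝔽^ suc m) 0ℓ} (E? : Decidable E) {N : ℝ} where

      -- Choose one point of `E` for each value of the functional. Their cosets are pairwise
      -- distinct and meet `E`, so the number `n` of values is at most `N`, and `length²≤collisions`
      -- applies with these values.
      projection-energy : ∀ {V w} → IsDirection V w → ∣ Projection V E ∣≤ N →
                          ∃ λ n → fromℕ n ≤ᵣ N × # E? * # E? ≤ n * energy E? w
      projection-energy {V} {w} (_ , Vw , _) few = length reps , reps≤N ,
        subst (λ n → # E? * # E? ≤ n * energy E? w) (length-map g reps)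
          (length²≤collisions _≟ᶠ_ g (points E?) (AllPairs.map⁺ reps!) covered)
        where
        g : 𝔽^ suc m → Carrier
        g x = init x ∙ w
        reps : List (𝔽^ suc m)
        reps = deduplicate (λ x y → g x ≟ᶠ g y) (points E?)
        reps! : AllPairs (λ x y → g x ≢ g y) reps
        reps! = UniqueDecSetoid.deduplicate-! (On.decSetoid (decSetoid _≟ᶠ_) g) (points E?)
        covered : ∀ {x} → x ∈ points E? → g x ∈ map g reps
        covered x∈ = Any.map⁺ (Any.deduplicate⁺ (λ x y → g x ≟ᶠ g y) (λ e e′ → trans e′ (sym e)) (Any.map (cong g) x∈))
        coset-∙ : ∀ {x y} → Coset x (V ^⊥) ≐ Coset y (V ^⊥) → g x ≡ g y
        coset-∙ {x} {y} eq = trans (sym (∙-∷ʳ0 x w)) (trans (coset-∙-injective Vw eq) (∙-∷ʳ0 y w))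
        meets : ∀ {x} → x ∈ reps → Projection V E (Coset x (V ^⊥))
        meets {x} x∈ = x , (id , id) , x , (0ᵥ , (λ z _ → ∙-zeroˡ z) , sym (+ᵥ-identityʳ x)) ,
          proj₂ (∈-filter⁻ E? {xs = vectors (suc m)} (∈-deduplicate⁻ (λ x y → g x ≟ᶠ g y) (points E?) x∈))
        reps≤N : fromℕ (length reps) ≤ᵣ N
        reps≤N = subst (λ n → fromℕ n ≤ᵣ N) (length-map (λ x → Coset x (V ^⊥)) reps)
          (few (map (λ x → Coset x (V ^⊥)) reps)
            (AllPairs.map⁺ (AllPairs.map (λ {x} {y} gx≢gy eq → gx≢gy (coset-∙ {x} {y} eq)) reps!))
            (All.map⁺ (All.tabulate meets)))

      -- Summing over the lines calls for one integer `n` that works for all of them. The maximum of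
      -- the counts is itself one of the counts, or 0 at the start, so it stays below `N`, and
      -- enlarging `n` only weakens the energy inequality.
      directions-energy : ∀ {Vs} → fromℕ 0 ≤ᵣ N → (ls : All (LinesMeeting 0#) Vs) →
                          All (λ V → ∣ Projection V E ∣≤ N) Vs →
                          ∃ λ n → fromℕ n ≤ᵣ N × All (λ w → # E? * # E? ≤ n * energy E? w) (directions ls)
      directions-energy 0≤N []       []           = 0 , 0≤N , []
      directions-energy 0≤N (l ∷ ls) (few ∷ fews) =
        combine (projection-energy (proj₂ (direction l)) few) (directions-energy 0≤N ls fews)
        where
        combine : ∀ {w ws} → (∃ λ n → fromℕ n ≤ᵣ N × # E? * # E? ≤ n * energy E? w) →
                  (∃ λ n → fromℕ n ≤ᵣ N × All (λ w → # E? * # E? ≤ n * energy E? w) ws) →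
                  ∃ λ n → fromℕ n ≤ᵣ N × All (λ w → # E? * # E? ≤ n * energy E? w) (w ∷ ws)
        combine (n , n≤N , h) (n′ , n′≤N , hs) = n ⊔ n′
          , [ (λ e → subst (λ k → fromℕ k ≤ᵣ N) (sym e) n≤N)
            , (λ e → subst (λ k → fromℕ k ≤ᵣ N) (sym e) n′≤N) ]′ (⊔-sel n n′)
          , ≤-trans h (*-monoˡ-≤ _ (m≤m⊔n n n′))
          ∷ All.map (λ h → ≤-trans h (*-monoˡ-≤ _ (m≤n⊔m n n′))) hs

theorem1p5 : (q : ℕ) → OddPrimePower q → (F : FiniteField q) →
    let open Geometry F in
    (m : ℕ) → let d = suc m in 3 ≤ d →
    (E : Pred (𝔽^ d) 0ℓ) (E? : Decidable E) (E≠∅ : Satisfiable E) →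
    (N : ℝ) → fromℕ 0 <ᵣ N → (N<q : N <ᵣ fromℕ q) →
    ∣ 𝒯₁ (LinesMeeting 0#) E N ∣≤
    (((fromℕ (2 * q ^ m) *ᵣ N)
    /ᵣ ((fromℕ q -ᵣ N) *ᵣ fromℕ (# E?)) [ 0<[q-N]#E N E? E≠∅ N<q ])
    *ᵣ fromℕ (maxFibreSize E?))
theorem1p5 q _ F m _ E E? E≠∅ N 0<N N<q Vs Vs! Vs∈𝒯 =
  conclude (directions-energy E? {N} (<ᵣ⇒≤ᵣ {fromℕ 0} {N} 0<N) lines (All.map proj₂ Vs∈𝒯))
  where
  open Geometry F
  open FiniteFieldGeometry F
  open ≤-Reasoning
  lines : All (LinesMeeting 0#) Vs
  lines = All.map proj₁ Vs∈𝒯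
  K M e : ℕ
  K = length Vs
  M = maxFibreSize E?
  e = # E?
  conclude : (∃ λ n → fromℕ n ≤ᵣ N × All (λ w → e * e ≤ n * energy E? w) (directions lines)) →
    fromℕ K ≤ᵣ (((fromℕ (2 * q ^ m) *ᵣ N)
      /ᵣ ((fromℕ q -ᵣ N) *ᵣ fromℕ (# E?)) [ 0<[q-N]#E N E? E≠∅ N<q ]) *ᵣ fromℕ M)
  -- The counting is done with the integer `n`; the real `N` replaces it in the passage to the
  -- quotient.
  conclude (n , n≤N , energetic) = ≤ᵣ-quotient {K} {q} {e} {2 * q ^ m} {M} {n} N (0<[q-N]#E N E? E≠∅ N<q) n≤N (begin
    K * q * e                          ≤⟨ subst (λ k → k * q * e ≤ q ^ m * n * M + k * n * e) (length-directions lines)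
                                            (directions-≤ E? {n} (0<# E? E≠∅) (directions-≢0 lines)
                                              (directions-NonProportional lines Vs!) energetic) ⟩
    -- Adding a second copy of `q ^ m` produces the factor 2 of the bound.
    q ^ m * n * M + K * n * e          ≤⟨ +-monoˡ-≤ (K * n * e) (*-monoˡ-≤ M (*-monoˡ-≤ n (m≤m+n (q ^ m) _))) ⟩
    2 * q ^ m * n * M + K * n * e      ∎)
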